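{- For $n\ge1$, $$\sum_{\pi\in\mathfrak{S}_n(213)}t^{\mathsf{des}\,\pi}q^{\mathsf{adi}\,\pi}=\sum_{\pi\in\mathfrak{S}_n(132)}t^{\mathsf{des}\,\pi}q^{\mathsf{adi}^*\,\pi}=\sum_{k=0}^{\lfloor (n-1)/2\rfloor}\Big(\sum_{\pi\in\widetilde{\mathfrak{S}}_{n,k}(213)}q^{\mathsf{adi}\,\pi}\Big)t^k(1+t)^{n-1-2k}=\sum_{k=0}^{\lfloor (n-1)/2\rfloor}\Big(\sum_{\pi\in\widetilde{\mathfrak{S}}_{n,k}(132)}q^{\mathsf{adi}^*\,\pi}\Big)t^k(1+t)^{n-1-2k}.$$
   Context: $\mathfrak{S}_n(\tau)$: permutations of $[n]$ avoiding the classical pattern $\tau$. $\mathsf{des}\,\pi=\#\{i\in[n-1]:\pi(i)>\pi(i+1)\}$. Admissible inversions: set $\pi(n+1)=0$; an inversion pair $(\pi(i),\pi(j))$ ($1\le i<j\le n$, $\pi(i)>\pi(j)$) is admissible if $\pi(j)<\pi(j+1)$ or there is $l$ with $i<l<j$ and $\pi(l)<\pi(j)$; $\mathsf{adi}\,\pi$ counts them. Star admissible: set $\pi(0)=n+1$; an inversion pair $(\pi(i),\pi(j))$ with $i<j$ is star admissible if $\pi(i-1)<\pi(i)$ or there is $l$ with $i<l<j$ and $\pi(l)>\pi(i)$; $\mathsf{adi}^*\,\pi$ counts them. $\mathsf{dd}\,\pi$ is the number of $i\in[n]$ with $\pi(i-1)>\pi(i)>\pi(i+1)$ under $\pi(0)=\pi(n+1)=0$;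 $\mathsf{dd}^*\,\pi$ is the same with $\pi(0)=\pi(n+1)=n+1$. $\widetilde{\mathfrak{S}}_{n,k}(213)=\{\pi\in\mathfrak{S}_n(213):\mathsf{dd}\,\pi=0,\mathsf{des}\,\pi=k\}$, $\widetilde{\mathfrak{S}}_{n,k}(132)=\{\pi\in\mathfrak{S}_n(132):\mathsf{dd}^*\,\pi=0,\mathsf{des}\,\pi=k\}$. -}

module Defs where

open import Algebra.Bundles using (CommutativeSemiring)
open import Data.Fin as Fin using (Fin; toℕ; fromℕ<; #_)
import Data.Fin.Properties as Fin
open import Data.List.Base using (List; []; _∷_; allFin; applyUpTo; cartesianProduct; cartesianProductWith; filter; foldr; length)
open import Data.Nat.Base using (ℕ; zero; suc; _∸_; _<_)
open import Data.Nat.Properties using (_<?_; _≟_; anyUpTo?)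
open import Data.Product.Base using (∃; _×_; _,_; uncurry)
open import Data.Sum.Base using (_⊎_)
open import Data.Vec.Base using (Vec; []; _∷_; lookup)
open import Function.Definitions using (Injective)
open import Level using (Level)
open import Relation.Binary.PropositionalEquality using (_≡_)
open import Relation.Nullary.Decidable using (Dec; yes; no; map′; ¬?; _×-dec_; _⊎-dec_; _→-dec_)
open import Relation.Nullary.Negation using (¬_)
open import Relation.Unary using (Pred; Decidable)

private
  variable
    a p c ℓ : Level
    k n : ℕ

-- A word π(1) ⋯ π(n) over [n].  The value v ∈ [n] is stored as the element
-- v - 1 of Fin n, and likewise for positions.
Word : ℕ → Set
Word n = Vec (Fin n) n

IsPermutation : Word n → Set
IsPermutation π = Injective _≡_ _≡_ (lookup π)

-- p lists positions p₁ < ⋯ < p_k of π at which π is order-isomorphic to τ.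
Occurrence : Word k → Word n → Vec (Fin n) k → Set
Occurrence τ π p =
  (∀ x y → x Fin.< y → lookup p x Fin.< lookup p y) ×
  (∀ x y → (lookup τ x Fin.< lookup τ y → π∘p x Fin.< π∘p y) ×
           (π∘p x Fin.< π∘p y → lookup τ x Fin.< lookup τ y))
  where π∘p = λ x → lookup π (lookup p x)

Contains : Word k → Word n → Set
Contains τ π = ∃ (Occurrence τ π)

IsAvoidingPermutation : Word k → Word n → Set
IsAvoidingPermutation τ π = IsPermutation π × ¬ Contains τ π

isPermutation? : Decidable (IsPermutation {n})
isPermutation? π = map′ (λ f {x} {y} → f x y) (λ f x y → f {x} {y})
  (Fin.all? λ x → Fin.all? λ y → (lookup π x Fin.≟ lookup π y) →-dec (x Fin.≟ y))

occurrence? : (τ : Word k) (π : Word n) → Decidable (Occurrence τ π)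
occurrence? τ π p =
  (Fin.all? λ x → Fin.all? λ y → (x Fin.<? y) →-dec (lookup p x Fin.<? lookup p y)) ×-dec
  (Fin.all? λ x → Fin.all? λ y →
    ((lookup τ x Fin.<? lookup τ y) →-dec (π∘p x Fin.<? π∘p y)) ×-dec
    ((π∘p x Fin.<? π∘p y) →-dec (lookup τ x Fin.<? lookup τ y)))
  where π∘p = λ x → lookup π (lookup p x)

anyVec? : {P : Pred (Vec (Fin n) k) p} → Decidable P → Dec (∃ P)
anyVec? {k = zero}  P? = map′ ([] ,_) (λ { ([] , h) → h }) (P? [])
anyVec? {k = suc _} P? =
  map′ (λ { (x , v , h) → x ∷ v , h }) (λ { (x ∷ v , h) → x , v , h })
       (Fin.any? λ x → anyVec? λ v → P? (x ∷ v))

isAvoidingPermutation? : (τ : Word k) → Decidable (IsAvoidingPermutation {n = n} τ)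
isAvoidingPermutation? τ π = isPermutation? π ×-dec ¬? (anyVec? (occurrence? τ π))

words : (n k : ℕ) → List (Vec (Fin n) k)
words n zero    = [] ∷ []
words n (suc k) = cartesianProductWith _∷_ (allFin n) (words n k)

-- 𝔖 n τ lists, without repetition, the permutations of [n] avoiding τ.
𝔖 : (n : ℕ) → Word k → List (Word n)
𝔖 n τ = filter (isAvoidingPermutation? τ) (words n n)

τ213 τ132 : Word 3
τ213 = # 1 ∷ # 0 ∷ # 2 ∷ []
τ132 = # 0 ∷ # 2 ∷ # 1 ∷ []

-- The sequence i ↦ π(i) with 1-based positions and values, and with
-- π(0) = π(n+1) = s (positions beyond n+1 are never consulted).
extend : ℕ → Word n → ℕ → ℕ
extend s π zero = s
extend {n} s π (suc i) with i <? n
... | yes i<n = suc (toℕ (lookup π (fromℕ< i<n)))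
... | no  _   = s

[1⋯_] : ℕ → List ℕ
[1⋯ m ] = applyUpTo suc m

count : {A : Set a} {P : Pred A p} → Decidable P → List A → ℕ
count P? xs = length (filter P? xs)

-- The boundary value passed to extend is irrelevant: only positions 1, …, n occur.
des : Word n → ℕ
des {n} π = count (λ i → w (suc i) <? w i) [1⋯ n ∸ 1 ]
  where w = extend 0 π

doubleDescents : ℕ → Word n → ℕ
doubleDescents {n} s π =
  count (λ i → (w i <? w (i ∸ 1)) ×-dec (w (suc i) <? w i)) [1⋯ n ]
  where w = extend s π

dd dd* : Word n → ℕ
dd      π = doubleDescents 0 π
dd* {n} π = doubleDescents (suc n) π

Inversion : (ℕ → ℕ) → ℕ → ℕ → Set
Inversion w i j = i < j × w j < w i

inversion? : ∀ w i j → Dec (Inversion w i j)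
inversion? w i j = (i <? j) ×-dec (w j <? w i)

Admissible : (ℕ → ℕ) → ℕ → ℕ → Set
Admissible w i j = Inversion w i j ×
  (w j < w (suc j) ⊎ ∃ λ l → l < j × (i < l × w l < w j))

StarAdmissible : (ℕ → ℕ) → ℕ → ℕ → Set
StarAdmissible w i j = Inversion w i j ×
  (w (i ∸ 1) < w i ⊎ ∃ λ l → l < j × (i < l × w i < w l))

admissible? : ∀ w i j → Dec (Admissible w i j)
admissible? w i j = inversion? w i j ×-dec
  ((w j <? w (suc j)) ⊎-dec anyUpTo? (λ l → (i <? l) ×-dec (w l <? w j)) j)

starAdmissible? : ∀ w i j → Dec (StarAdmissible w i j)
starAdmissible? w i j = inversion? w i j ×-dec
  ((w (i ∸ 1) <? w i) ⊎-dec anyUpTo? (λ l → (i <? l) ×-dec (w i <? w l)) j)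

-- adi consults only the boundary π(n+1) = 0, and adi* only π(0) = n+1.
-- Entries of a permutation are distinct, so pairs of positions stand for
-- pairs of values.
adi adi* : Word n → ℕ
adi  {n} π = count (uncurry (admissible? (extend 0 π))) (cartesianProduct [1⋯ n ] [1⋯ n ])
adi* {n} π = count (uncurry (starAdmissible? (extend (suc n) π))) (cartesianProduct [1⋯ n ] [1⋯ n ])

𝔖̃213 𝔖̃132 : (n k : ℕ) → List (Word n)
𝔖̃213 n k = filter (λ π → (dd  π ≟ 0) ×-dec (des π ≟ k)) (𝔖 n τ213)
𝔖̃132 n k = filter (λ π → (dd* π ≟ 0) ×-dec (des π ≟ k)) (𝔖 n τ132)

module Sum (R : CommutativeSemiring c ℓ) where
  open CommutativeSemiring R using (Carrier; _+_; 0#)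

  ∑ : {A : Set a} → List A → (A → Carrier) → Carrier
  ∑ xs f = foldr (λ x s → f x + s) 0# xs

  syntax ∑ xs (λ x → e) = ∑[ x ∈ xs ] e

{-# OPTIONS --safe #-}

-- A 213-avoiding permutation factors as L 1 R with every entry of L above every entry of R,
-- hence corresponds to a binary tree.  A node with subtrees of sizes i and j contributes
-- [i > 0] to des, i(j + [j > 0]) to adi and [i > 0 = j] to dd.  Both sums over 213-avoiders
-- are therefore sums over trees of products of weights depending only on (i , j).  The two
-- weights agree except at nodes with exactly one child, where t (left) plus 1 (right) is
-- replaced by 0 plus 1 + t, and adi does not see on which side the child is.
-- For a tree without double descents, n - 1 - 2 des counts the right-only nodes.
-- Reverse-complement carries 132, adi*, dd* to 213, adi, dd and preserves des.

module Submission where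

open import Defs
open import Algebra.Bundles using (CommutativeSemiring)
open import Algebra.Properties.Semiring.Exp using () renaming (_^_ to pow)
open import Data.List.Base using (List; []; _∷_; _++_; applyUpTo; cartesianProduct; cartesianProductWith; concatMap; filter; length; map; upTo)
open import Data.List.Membership.Propositional using (_∈_; find; lose)
open import Data.List.Membership.Propositional.Properties
open import Data.List.Relation.Unary.All as All using ()
open import Data.List.Relation.Unary.AllPairs as AllPairs using ([]; _∷_)
open import Data.List.Relation.Unary.Any using (here; there)
open import Data.List.Relation.Unary.Unique.Propositional using (Unique)
import Data.List.Relation.Unary.Unique.Propositional.Properties as Unique
open import Data.Nat.Base as ℕ using (ℕ; zero; suc; _≤_; _<_; _∸_; s≤s; z≤n; ⌊_/2⌋)
open import Data.Product.Base using (∃; ∃₂; _×_; _,_; proj₁; proj₂; uncurry)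
open import Data.Sum.Base using (_⊎_; inj₁; inj₂)
open import Function.Base using (_∘_)
open import Relation.Nullary.Decidable using (Dec; yes; no; does; _×-dec_)
open import Relation.Nullary.Negation using (¬_; contradiction)
open import Relation.Unary using (Decidable)

-- The two weights do not agree tree by tree: a left-only node carries `t` in one and 0 in the
-- other. They can be compared only after summation, so `total-cong` runs on the convolution
-- recurrence over the sizes of the two subtrees, where the splittings `0 , m` and `m , 0` carry the
-- same product of smaller sums. `adi` is blind to the side of an only child because `cross i j`
-- vanishes as soon as one of the sizes is 0.
--
-- A subword of a permutation is in general not a word over an initial segment of values. A tree is
-- therefore attached to an interval of the sequence `extend 0 π` by comparisons alone, and each
-- statistic is read off in place, a smaller neighbouring entry acting as the boundary 0. The price
-- is that a tree visibly fixes only the relative order of the entries; that this pins down a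
-- permutation of `Fin n` is a separate argument, `order⇒≤`.
--
-- Both correspondences, with trees and under reverse-complement, enter the sums as relations that
-- are functional and injective, since a tree is extracted only from a proof of avoidance.

module Combinatorics where

  open import Algebra.Properties.CommutativeSemigroup using (interchange)
  open import Data.Fin.Base as Fin using (Fin; zero; suc; toℕ; fromℕ<; opposite)
  import Data.Fin.Properties as Fin
  open import Data.List.Properties using (filter-++; length-++)
  open import Data.List.Relation.Binary.Disjoint.Propositional using (Disjoint)
  import Data.List.Relation.Unary.All.Properties as All
  import Data.List.Relation.Unary.AllPairs.Properties as AllPairs
  open import Data.Nat.Base using (_+_; _*_)
  open import Data.Nat.Properties
  open import Data.Nat.Solver using (module +-*-Solver)
  open import Data.Vec.Base using (Vec; []; _∷_; lookup; tabulate)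
  open import Data.Vec.Properties using (∷-injective; lookup∘tabulate; tabulate∘lookup; tabulate-cong)
  open import Function.Definitions using (Injective)
  open import Level using (Level)
  open import Relation.Binary.Definitions using (tri<; tri≈; tri>)
  open import Relation.Binary.PropositionalEquality

  -- Sums and counts over ranges of integers

  private
    variable
      ℓ₁ ℓ₂ : Level
      P : Set ℓ₁
      Q : Set ℓ₂
      n k : ℕ

  ind : Dec P → ℕ
  ind (yes _) = 1
  ind (no  _) = 0

  ind-cong : (d : Dec P) (e : Dec Q) → (P → Q) → (Q → P) → ind d ≡ ind e
  ind-cong (yes _) (yes _) _ _ = refl
  ind-cong (no  _) (no  _) _ _ = refl
  ind-cong (yes p) (no ¬q) f _ = contradiction (f p) ¬q
  ind-cong (no ¬p) (yes q) _ g = contradiction (g q) ¬p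

  ind-yes : (d : Dec P) → P → ind d ≡ 1
  ind-yes (yes _) _ = refl
  ind-yes (no ¬p) p = contradiction p ¬p

  ind-no : (d : Dec P) → ¬ P → ind d ≡ 0
  ind-no (yes p) ¬p = contradiction p ¬p
  ind-no (no _)  _  = refl

  -- Start and length instead of two endpoints: the blocks of `node l r` are then given directly by
  -- `size l` and `size r`.
  _∈[_,+_⟩ : ℕ → ℕ → ℕ → Set
  i ∈[ a ,+ m ⟩ = a ≤ i × i < a + m

  ∉-empty : ∀ {ℓ} {A : Set ℓ} {a i} → i ∈[ a ,+ 0 ⟩ → A
  ∉-empty (a≤i , i<) = contradiction (≤-trans (≤-reflexive (+-identityʳ _)) a≤i) (<⇒≱ i<)

  split-range : ∀ a m k {i} → i ∈[ a ,+ m + suc k ⟩ →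
                i ∈[ a ,+ m ⟩ ⊎ i ≡ a + m ⊎ i ∈[ suc (a + m) ,+ k ⟩
  split-range a m k {i} (a≤i , i<) with <-cmp i (a + m)
  ... | tri< lt _ _ = inj₁ (a≤i , lt)
  ... | tri≈ _ eq _ = inj₂ (inj₁ eq)
  ... | tri> _ _ gt = inj₂ (inj₂ (gt , subst (i <_) (trans (sym (+-assoc a m (suc k))) (+-suc (a + m) k)) i<))

  range-left : ∀ {a} m k {i} → i ∈[ a ,+ m ⟩ → i ∈[ a ,+ m + suc k ⟩
  range-left {a} m k (a≤i , i<) = a≤i , ≤-trans i< (+-monoʳ-≤ a (m≤m+n m (suc k)))

  range-middle : ∀ {a} m k → (a + m) ∈[ a ,+ m + suc k ⟩
  range-middle {a} m k = m≤m+n a m , +-monoʳ-< a (m<m+n m 0<1+n)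

  range-right : ∀ {a} m k {i} → i ∈[ suc (a + m) ,+ k ⟩ → i ∈[ a ,+ m + suc k ⟩
  range-right {a} m k {i} (a≤i , i<) =
    ≤-trans (m≤m+n a m) (≤-trans (n≤1+n _) a≤i) ,
    subst (i <_) (sym (trans (sym (+-assoc a m (suc k))) (+-suc (a + m) k))) i<

  Σ[_] : (ℕ → ℕ) → ℕ → ℕ → ℕ
  Σ[ f ] a zero    = 0
  Σ[ f ] a (suc m) = f a + Σ[ f ] (suc a) m

  Σ-cong : ∀ {f g} a m → (∀ {i} → i ∈[ a ,+ m ⟩ → f i ≡ g i) → Σ[ f ] a m ≡ Σ[ g ] a m
  Σ-cong a zero    h = refl
  Σ-cong a (suc m) h = cong₂ _+_ (h (≤-refl , m<m+n a 0<1+n))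
    (Σ-cong (suc a) m λ { {i} (a<i , i<) → h (<⇒≤ a<i , subst (i <_) (sym (+-suc a m)) i<) })

  Σ-const : ∀ c a m → Σ[ (λ _ → c) ] a m ≡ m * c
  Σ-const c a zero    = refl
  Σ-const c a (suc m) = cong (c +_) (Σ-const c (suc a) m)

  Σ-constant : ∀ {f} c a m → (∀ {i} → i ∈[ a ,+ m ⟩ → f i ≡ c) → Σ[ f ] a m ≡ m * c
  Σ-constant c a m h = trans (Σ-cong a m h) (Σ-const c a m)

  Σ-zero : ∀ {f} a m → (∀ {i} → i ∈[ a ,+ m ⟩ → f i ≡ 0) → Σ[ f ] a m ≡ 0
  Σ-zero a m h = trans (Σ-constant 0 a m h) (*-zeroʳ m)

  Σ-shift : ∀ f a m → Σ[ f ] (suc a) m ≡ Σ[ f ∘ suc ] a m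
  Σ-shift f a zero    = refl
  Σ-shift f a (suc m) = cong (f (suc a) +_) (Σ-shift f (suc a) m)

  Σ-split : ∀ f a m k → Σ[ f ] a (m + suc k) ≡ Σ[ f ] a m + (f (a + m) + Σ[ f ] (suc (a + m)) k)
  Σ-split f a zero    k rewrite +-identityʳ a = refl
  Σ-split f a (suc m) k rewrite +-suc a m =
    trans (cong (f a +_) (Σ-split f (suc a) m k)) (sym (+-assoc (f a) _ _))

  Σ-+ : ∀ f g a m → Σ[ (λ i → f i + g i) ] a m ≡ Σ[ f ] a m + Σ[ g ] a m
  Σ-+ f g a zero    = refl
  Σ-+ f g a (suc m) = begin
    f a + g a + Σ[ (λ i → f i + g i) ] (suc a) m     ≡⟨ cong (f a + g a +_) (Σ-+ f g (suc a) m) ⟩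
    f a + g a + (Σ[ f ] (suc a) m + Σ[ g ] (suc a) m) ≡⟨ interchange +-commutativeSemigroup (f a) (g a) _ _ ⟩
    f a + Σ[ f ] (suc a) m + (g a + Σ[ g ] (suc a) m) ∎
    where open ≡-Reasoning

  Σ-swap : ∀ (f : ℕ → ℕ → ℕ) a m b k →
           Σ[ (λ i → Σ[ f i ] b k) ] a m ≡ Σ[ (λ j → Σ[ (λ i → f i j) ] a m) ] b k
  Σ-swap f a zero    b k = sym (Σ-zero b k λ _ → refl)
  Σ-swap f a (suc m) b k =
    trans (cong (Σ[ f a ] b k +_) (Σ-swap f (suc a) m b k)) (sym (Σ-+ (f a) _ b k))

  Σ-reverse : ∀ f n → Σ[ f ] 1 n ≡ Σ[ (λ i → f (suc n ∸ i)) ] 1 n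
  Σ-reverse f zero    = refl
  Σ-reverse f (suc n) = begin
    Σ[ f ] 1 (suc n)                                      ≡⟨ cong (Σ[ f ] 1) (+-comm 1 n) ⟩
    Σ[ f ] 1 (n + 1)                                      ≡⟨ Σ-split f 1 n 0 ⟩
    Σ[ f ] 1 n + (f (suc n) + 0)                          ≡⟨ cong₂ _+_ (Σ-reverse f n) (+-identityʳ _) ⟩
    Σ[ (λ i → f (suc n ∸ i)) ] 1 n + f (suc n)            ≡⟨ +-comm _ (f (suc n)) ⟩
    f (suc n) + Σ[ (λ i → f (suc n ∸ i)) ] 1 n            ≡⟨ cong (f (suc n) +_) (Σ-shift _ 1 n) ⟨
    f (suc n) + Σ[ (λ i → f (suc (suc n) ∸ i)) ] 2 n      ∎
    where open ≡-Reasoning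

  module _ {a p} {A : Set a} {P : A → Set p} (P? : Decidable P) where

    count-∷ : ∀ x xs → count P? (x ∷ xs) ≡ ind (P? x) + count P? xs
    count-∷ x xs with P? x
    ... | yes _ = refl
    ... | no  _ = refl

    count-++ : ∀ xs ys → count P? (xs ++ ys) ≡ count P? xs + count P? ys
    count-++ xs ys = trans (cong length (filter-++ P? xs ys)) (length-++ (filter P? xs))

    -- The offset `a` is general because the tail of `applyUpTo f` is `applyUpTo (f ∘ suc)`, so the
    -- induction moves the starting point.
    count-applyUpTo : ∀ (f : ℕ → A) g a m → (∀ i → ind (P? (f i)) ≡ g (a + i)) →
                      count P? (applyUpTo f m) ≡ Σ[ g ] a m
    count-applyUpTo f g a zero    h = refl
    count-applyUpTo f g a (suc m) h = trans (count-∷ (f 0) _) (cong₂ _+_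
      (trans (h 0) (cong g (+-identityʳ a)))
      (count-applyUpTo (f ∘ suc) g (suc a) m λ i → trans (h (suc i)) (cong g (+-suc a i))))

  count-[1⋯] : ∀ {p} {P : ℕ → Set p} (P? : Decidable P) m → count P? [1⋯ m ] ≡ Σ[ (λ i → ind (P? i)) ] 1 m
  count-[1⋯] P? m = count-applyUpTo P? suc _ 1 m λ _ → refl

  module _ {p} {P : ℕ → ℕ → Set p} (P? : ∀ i j → Dec (P i j)) where

    count-map : ∀ i js → count (uncurry P?) (map (i ,_) js) ≡ count (P? i) js
    count-map i []       = refl
    count-map i (j ∷ js) = trans (count-∷ (uncurry P?) (i , j) _)
      (trans (cong (ind (P? i j) +_) (count-map i js)) (sym (count-∷ (P? i) j js)))

    count-cartesianProduct : ∀ (f : ℕ → ℕ) g a m js → (∀ i → count (P? (f i)) js ≡ g (a + i)) →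
      count (uncurry P?) (cartesianProduct (applyUpTo f m) js) ≡ Σ[ g ] a m
    count-cartesianProduct f g a zero    js h = refl
    count-cartesianProduct f g a (suc m) js h = trans (count-++ (uncurry P?) (map (f 0 ,_) js) _)
      (cong₂ _+_
        (trans (count-map (f 0) js) (trans (h 0) (cong g (+-identityʳ a))))
        (count-cartesianProduct (f ∘ suc) g (suc a) m js λ i → trans (h (suc i)) (cong g (+-suc a i))))

    count-[1⋯]² : ∀ m → count (uncurry P?) (cartesianProduct [1⋯ m ] [1⋯ m ])
                        ≡ Σ[ (λ i → Σ[ (λ j → ind (P? i j)) ] 1 m) ] 1 m
    count-[1⋯]² m = count-cartesianProduct suc _ 1 m [1⋯ m ] λ i → count-[1⋯] (P? (suc i)) m

  -- Binary trees and 213-avoiding sequences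

  data Tree : Set where
    leaf : Tree
    node : Tree → Tree → Tree

  size : Tree → ℕ
  size leaf       = 0
  size (node l r) = size l + suc (size r)

  [_>0] : ℕ → ℕ
  [ zero  >0] = 0
  [ suc _ >0] = 1

  -- In L 1 R every entry of L forms an admissible inversion with every entry of R
  -- (1 lies between them and is smaller), and with 1 itself iff R is nonempty.
  cross : ℕ → ℕ → ℕ
  cross i j = i * (j + [ j >0])

  doubleDescent : ℕ → ℕ → ℕ
  doubleDescent (suc _) zero = 1
  doubleDescent _       _    = 0

  desᵀ ddᵀ adiᵀ : Tree → ℕ
  desᵀ leaf       = 0
  desᵀ (node l r) = desᵀ l + ([ size l >0] + desᵀ r)
  ddᵀ  leaf       = 0
  ddᵀ  (node l r) = ddᵀ l + (doubleDescent (size l) (size r) + ddᵀ r)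
  adiᵀ leaf       = 0
  adiᵀ (node l r) = adiᵀ l + (cross (size l) (size r) + adiᵀ r)

  -- The entries of w at positions a, …, a + size T ∸ 1 have the shape L 1 R prescribed
  -- by T.  Only comparisons are recorded, so that the positions and values of subwords
  -- need no renumbering.
  data Realizes (w : ℕ → ℕ) : Tree → ℕ → Set where
    leaf : ∀ {a} → Realizes w leaf a
    node : ∀ {l r a} →
      (∀ {i} → i ∈[ a ,+ size l ⟩ → w (a + size l) < w i) →
      (∀ {k} → k ∈[ suc (a + size l) ,+ size r ⟩ → w (a + size l) < w k) →
      (∀ {i k} → i ∈[ a ,+ size l ⟩ → k ∈[ suc (a + size l) ,+ size r ⟩ → w k < w i) →
      Realizes w l a → Realizes w r (suc (a + size l)) → Realizes w (node l r) a

  InjectiveOn : (ℕ → ℕ) → ℕ → ℕ → Set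
  InjectiveOn w a m = ∀ {i j} → i ∈[ a ,+ m ⟩ → j ∈[ a ,+ m ⟩ → w i ≡ w j → i ≡ j

  Avoids213On : (ℕ → ℕ) → ℕ → ℕ → Set
  Avoids213On w a m = ∀ {i j k} → i ∈[ a ,+ m ⟩ → j ∈[ a ,+ m ⟩ → k ∈[ a ,+ m ⟩ →
    i < j → j < k → ¬ (w j < w i × w i < w k)

  -- `x` and `y` are the numbers of entries before and after the minimum, in the form `x + suc y`
  -- that `size (node l r)` takes.
  argmin : ∀ w a m → ∃₂ λ x y → x + suc y ≡ suc m × (∀ {i} → i ∈[ a ,+ suc m ⟩ → w (a + x) ≤ w i)
  argmin w a zero = 0 , 0 , refl , λ { {i} (a≤i , i<) →
    ≤-reflexive (cong w (≤-antisym (≤-trans (≤-reflexive (+-identityʳ a)) a≤i)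
      (≤-pred (≤-trans i< (≤-reflexive (+-suc a 0)))))) }
  argmin w a (suc m) with argmin w (suc a) m
  ... | x , y , eq , min with w a ≤? w (suc a + x)
  ...   | yes le = 0 , suc m , refl , λ { {i} (a≤i , i<) → ≤-trans (≤-reflexive (cong w (+-identityʳ a))) (first i a≤i i<) }
    where
    first : ∀ i → a ≤ i → i < a + suc (suc m) → w a ≤ w i
    first i a≤i i< with m≤n⇒m<n∨m≡n a≤i
    ... | inj₁ a<i  = ≤-trans le (min (a<i , ≤-trans i< (≤-reflexive (+-suc a (suc m)))))
    ... | inj₂ refl = ≤-refl
  ...   | no nle = suc x , y , cong suc eq , λ { {i} (a≤i , i<) → ≤-trans (≤-reflexive (cong w (+-suc a x))) (rest i a≤i i<) }
    where
    rest : ∀ i → a ≤ i → i < a + suc (suc m) → w (suc a + x) ≤ w i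
    rest i a≤i i< with m≤n⇒m<n∨m≡n a≤i
    ... | inj₁ a<i  = min (a<i , ≤-trans i< (≤-reflexive (+-suc a (suc m))))
    ... | inj₂ refl = <⇒≤ (≰⇒> nle)

  -- An entry before the minimum and a larger one after it would form the pattern 213 with the
  -- minimum in the middle. Injectivity makes all the inequalities strict.
  min-at-root : ∀ w a x y → InjectiveOn w a (x + suc y) → Avoids213On w a (x + suc y) →
    (∀ {i} → i ∈[ a ,+ x + suc y ⟩ → w (a + x) ≤ w i) →
    (∀ {i} → i ∈[ a ,+ x ⟩ → w (a + x) < w i) ×
    (∀ {k} → k ∈[ suc (a + x) ,+ y ⟩ → w (a + x) < w k) ×
    (∀ {i k} → i ∈[ a ,+ x ⟩ → k ∈[ suc (a + x) ,+ y ⟩ → w k < w i)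
  min-at-root w a x y inj av min = root<left , root<right , right<left
    where
    root<left : ∀ {i} → i ∈[ a ,+ x ⟩ → w (a + x) < w i
    root<left i∈ = ≤∧≢⇒< (min (range-left x y i∈))
      λ e → <⇒≢ (proj₂ i∈) (sym (inj (range-middle x y) (range-left x y i∈) e))
    root<right : ∀ {k} → k ∈[ suc (a + x) ,+ y ⟩ → w (a + x) < w k
    root<right k∈ = ≤∧≢⇒< (min (range-right x y k∈))
      λ e → <⇒≢ (proj₁ k∈) (inj (range-middle x y) (range-right x y k∈) e)
    right<left : ∀ {i k} → i ∈[ a ,+ x ⟩ → k ∈[ suc (a + x) ,+ y ⟩ → w k < w i
    right<left i∈ k∈ = ≰⇒> λ wi≤wk →
      av (range-left x y i∈) (range-middle x y) (range-right x y k∈) (proj₂ i∈) (proj₁ k∈)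
        (root<left i∈ , ≤∧≢⇒< wi≤wk λ e →
          <⇒≢ (<-trans (proj₂ i∈) (proj₁ k∈)) (inj (range-left x y i∈) (range-right x y k∈) e))

  -- Recursion on both sides of the minimum. The bound `f` decreases structurally, which the lengths
  -- `x` and `y` returned by `argmin` do not.
  realize : ∀ f w a m → m ≤ f → InjectiveOn w a m → Avoids213On w a m → ∃ λ T → size T ≡ m × Realizes w T a
  realize f w a zero m≤f inj av = leaf , refl , leaf
  realize (suc f) w a (suc m) (s≤s m≤f) inj av with argmin w a m
  ... | x , y , eq , min = split eq inj av min
    where
    x+y≤f : x + y ≤ f
    x+y≤f = ≤-trans (≤-reflexive (suc-injective (trans (sym (+-suc x y)) eq))) m≤f
    split : ∀ {m} → x + suc y ≡ m → InjectiveOn w a m → Avoids213On w a m →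
            (∀ {i} → i ∈[ a ,+ m ⟩ → w (a + x) ≤ w i) → ∃ λ T → size T ≡ m × Realizes w T a
    split refl inj av min
      with root<left , root<right , right<left ← min-at-root w a x y inj av min
      with l , refl , L ← realize f w a x (≤-trans (m≤m+n x y) x+y≤f)
             (λ i j → inj (range-left x y i) (range-left x y j))
             (λ i j k → av (range-left x y i) (range-left x y j) (range-left x y k))
      with r , refl , R ← realize f w (suc (a + x)) y (≤-trans (m≤n+m y x) x+y≤f)
             (λ i j → inj (range-right x y i) (range-right x y j))
             (λ i j k → av (range-right x y i) (range-right x y j) (range-right x y k))
      = node l r , refl , node root<left root<right right<left L R

  -- An occurrence stays inside one subtree. If `i` is in the left block, then `k`, having the
  -- larger value, is there too, and so is `j` between them. The root cannot be at `i`, as nothing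
  -- is below it. If `i` is in the right block, so are the later `j` and `k`.
  Realizes⇒Avoids213On : ∀ {w T a} → Realizes w T a → Avoids213On w a (size T)
  Realizes⇒Avoids213On leaf i∈ _ _ _ _ _ = ∉-empty i∈
  Realizes⇒Avoids213On {w} {node l r} {a} (node p<l p<r r<l L R) {i} {j} {k} i∈ j∈ k∈ i<j j<k (wj<wi , wi<wk)
    with split-range a (size l) (size r) i∈ | split-range a (size l) (size r) j∈ | split-range a (size l) (size r) k∈
  ... | inj₁ i∈l | inj₁ j∈l | inj₁ k∈l = Realizes⇒Avoids213On L i∈l j∈l k∈l i<j j<k (wj<wi , wi<wk)
  ... | inj₁ i∈l | _ | inj₂ (inj₁ refl) = <-asym wi<wk (p<l i∈l)
  ... | inj₁ i∈l | _ | inj₂ (inj₂ k∈r) = <-asym wi<wk (r<l i∈l k∈r)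
  ... | inj₁ _ | inj₂ (inj₁ refl) | inj₁ (_ , k<) = <-asym j<k k<
  ... | inj₁ _ | inj₂ (inj₂ (j> , _)) | inj₁ (_ , k<) = <-asym (<-trans j> j<k) k<
  ... | inj₂ (inj₁ refl) | inj₁ (_ , j<) | _ = <-asym i<j j<
  ... | inj₂ (inj₁ refl) | inj₂ (inj₁ refl) | _ = <-irrefl refl i<j
  ... | inj₂ (inj₁ refl) | inj₂ (inj₂ j∈r) | _ = <-asym wj<wi (p<r j∈r)
  ... | inj₂ (inj₂ (i> , _)) | inj₁ (_ , j<) | _ = <-asym (<-trans i> i<j) j<
  ... | inj₂ (inj₂ (i> , _)) | inj₂ (inj₁ refl) | _ = <-asym i> i<j
  ... | inj₂ (inj₂ i∈r) | inj₂ (inj₂ (j> , _)) | inj₁ (_ , k<) = <-asym (<-trans j> j<k) k<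
  ... | inj₂ (inj₂ i∈r) | inj₂ (inj₂ (j> , _)) | inj₂ (inj₁ refl) = <-asym j> j<k
  ... | inj₂ (inj₂ i∈r) | inj₂ (inj₂ j∈r) | inj₂ (inj₂ k∈r) = Realizes⇒Avoids213On R i∈r j∈r k∈r i<j j<k (wj<wi , wi<wk)

  -- Two distinct positions are separated at some node, and there the comparison is dictated by the
  -- shape: root below right block below left block.
  order-determined : ∀ {w w′ T a} → Realizes w T a → Realizes w′ T a →
    ∀ {i j} → i ∈[ a ,+ size T ⟩ → j ∈[ a ,+ size T ⟩ → w i < w j → w′ i < w′ j
  order-determined leaf leaf i∈ _ _ = ∉-empty i∈
  order-determined {w} {w′} {node l r} {a} (node p<l p<r r<l L R) (node p<l′ p<r′ r<l′ L′ R′) i∈ j∈ wi<wj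
    with split-range a (size l) (size r) i∈ | split-range a (size l) (size r) j∈
  ... | inj₁ i∈l | inj₁ j∈l = order-determined L L′ i∈l j∈l wi<wj
  ... | inj₁ i∈l | inj₂ (inj₁ refl) = contradiction wi<wj (<-asym (p<l i∈l))
  ... | inj₁ i∈l | inj₂ (inj₂ j∈r) = contradiction wi<wj (<-asym (r<l i∈l j∈r))
  ... | inj₂ (inj₁ refl) | inj₁ j∈l = p<l′ j∈l
  ... | inj₂ (inj₁ refl) | inj₂ (inj₁ refl) = contradiction wi<wj (<-irrefl refl)
  ... | inj₂ (inj₁ refl) | inj₂ (inj₂ j∈r) = p<r′ j∈r
  ... | inj₂ (inj₂ i∈r) | inj₁ j∈l = r<l′ j∈l i∈r
  ... | inj₂ (inj₂ i∈r) | inj₂ (inj₁ refl) = contradiction wi<wj (<-asym (p<r i∈r))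
  ... | inj₂ (inj₂ i∈r) | inj₂ (inj₂ j∈r) = order-determined R R′ i∈r j∈r wi<wj

  Realizes⇒InjectiveOn : ∀ {w T a} → Realizes w T a → InjectiveOn w a (size T)
  Realizes⇒InjectiveOn leaf i∈ _ _ = ∉-empty i∈
  Realizes⇒InjectiveOn {w} {node l r} {a} (node p<l p<r r<l L R) i∈ j∈ wi≡wj
    with split-range a (size l) (size r) i∈ | split-range a (size l) (size r) j∈
  ... | inj₁ i∈l | inj₁ j∈l = Realizes⇒InjectiveOn L i∈l j∈l wi≡wj
  ... | inj₁ i∈l | inj₂ (inj₁ refl) = contradiction (sym wi≡wj) (<⇒≢ (p<l i∈l))
  ... | inj₁ i∈l | inj₂ (inj₂ j∈r) = contradiction (sym wi≡wj) (<⇒≢ (r<l i∈l j∈r))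
  ... | inj₂ (inj₁ refl) | inj₁ j∈l = contradiction wi≡wj (<⇒≢ (p<l j∈l))
  ... | inj₂ (inj₁ refl) | inj₂ (inj₁ refl) = refl
  ... | inj₂ (inj₁ refl) | inj₂ (inj₂ j∈r) = contradiction wi≡wj (<⇒≢ (p<r j∈r))
  ... | inj₂ (inj₂ i∈r) | inj₁ j∈l = contradiction wi≡wj (<⇒≢ (r<l j∈l i∈r))
  ... | inj₂ (inj₂ i∈r) | inj₂ (inj₁ refl) = contradiction (sym wi≡wj) (<⇒≢ (p<r i∈r))
  ... | inj₂ (inj₂ i∈r) | inj₂ (inj₂ j∈r) = Realizes⇒InjectiveOn R i∈r j∈r wi≡wj

  -- With roots at different positions, each would lie in a subtree of the other, so each root entry
  -- would be smaller than the other.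
  ¬root-further-right : ∀ {w l r l′ r′ a} → Realizes w (node l r) a → Realizes w (node l′ r′) a →
    size (node l r) ≡ size (node l′ r′) → ¬ size l < size l′
  ¬root-further-right {w} {l} {r} {l′} {r′} {a} (node _ p<r _ _ _) (node p<l′ _ _ _ _) eq lt = <-asym
    (p<l′ (m≤m+n a _ , +-monoʳ-< a lt))
    (p<r (+-monoʳ-< a lt , ≤-trans (proj₂ (range-middle (size l′) (size r′)))
      (≤-reflexive (trans (cong (a +_) (sym eq)) (trans (sym (+-assoc a _ _)) (+-suc _ _))))))

  -- The root sits at the minimum, which fixes the sizes of both subtrees; the rest is induction.
  tree-unique : ∀ {w T T′ a} → Realizes w T a → Realizes w T′ a → size T ≡ size T′ → T ≡ T′
  tree-unique {T = leaf} {leaf} _ _ _ = refl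
  tree-unique {T = leaf} {node l r} _ _ eq = contradiction (trans eq (+-suc (size l) (size r))) 0≢1+n
  tree-unique {T = node l r} {leaf} _ _ eq = contradiction (trans (sym eq) (+-suc (size l) (size r))) 0≢1+n
  tree-unique {w} {node l r} {node l′ r′} {a} X@(node _ _ _ L R) X′@(node _ _ _ L′ R′) eq
    with ≤-antisym (≮⇒≥ (¬root-further-right X′ X (sym eq))) (≮⇒≥ (¬root-further-right X X′ eq))
  ... | |l|≡|l′| = cong₂ node (tree-unique L L′ |l|≡|l′|)
    (tree-unique R (subst (λ m → Realizes w r′ (suc (a + m))) (sym |l|≡|l′|) R′)
      (suc-injective (+-cancelˡ-≡ (size l) _ _ (trans eq (cong (_+ _) (sym |l|≡|l′|))))))

  -- The word with tree T on the values o, …, o + size T ∸ 1, positions counted from 0;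
  -- positions beyond size T carry junk.
  values : Tree → ℕ → ℕ → ℕ
  values leaf       o i = o
  values (node l r) o i with <-cmp i (size l)
  ... | tri< _ _ _ = values l (suc (o + size r)) i
  ... | tri≈ _ _ _ = o
  ... | tri> _ _ _ = values r (suc o) (i ∸ suc (size l))

  module _ (l r : Tree) (o : ℕ) where

    values-left : ∀ {i} → i < size l → values (node l r) o i ≡ values l (suc (o + size r)) i
    values-left {i} i< with <-cmp i (size l)
    ... | tri< _ _ _ = refl
    ... | tri≈ i≮ _ _ = contradiction i< i≮
    ... | tri> i≮ _ _ = contradiction i< i≮

    values-root : values (node l r) o (size l) ≡ o
    values-root with <-cmp (size l) (size l)
    ... | tri< _ ≢ _ = contradiction refl ≢
    ... | tri≈ _ _ _ = refl
    ... | tri> _ ≢ _ = contradiction refl ≢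

    values-right : ∀ i → values (node l r) o (suc (size l + i)) ≡ values r (suc o) i
    values-right i with <-cmp (suc (size l + i)) (size l)
    ... | tri< _ _ ≯ = contradiction (s≤s (m≤m+n _ i)) ≯
    ... | tri≈ _ _ ≯ = contradiction (s≤s (m≤m+n _ i)) ≯
    ... | tri> _ _ _ = cong (values r (suc o)) (m+n∸m≡n (size l) i)

  values-range : ∀ T o {i} → i < size T → values T o i ∈[ o ,+ size T ⟩
  values-range leaf       o ()
  values-range (node l r) o {i} i< with <-cmp i (size l)
  ... | tri< i<l _ _ with lo , hi ← values-range l (suc (o + size r)) i<l =
    ≤-trans (m≤m+n o (size r)) (<⇒≤ lo) ,
    ≤-trans hi (≤-reflexive (begin-equality
      suc (o + size r + size l)   ≡⟨ cong suc (+-assoc o (size r) (size l)) ⟩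
      suc (o + (size r + size l)) ≡⟨ +-suc o _ ⟨
      o + (suc (size r) + size l) ≡⟨ cong (o +_) (+-comm (suc (size r)) (size l)) ⟩
      o + (size l + suc (size r)) ∎))
    where open ≤-Reasoning
  ... | tri≈ _ _ _ = ≤-refl , m<m+n o (≤-trans 0<1+n (m≤n+m (suc (size r)) (size l)))
  ... | tri> _ _ l<i with lo , hi ← values-range r (suc o) (+-cancelˡ-< (suc (size l)) _ _
          (≤-trans (s≤s (≤-reflexive (m+[n∸m]≡n l<i))) (≤-trans i< (≤-reflexive (+-suc (size l) (size r)))))) =
    <⇒≤ lo , ≤-trans hi (≤-trans (≤-reflexive (sym (+-suc o (size r)))) (+-monoʳ-≤ o (m≤n+m _ (size l))))

  -- The three blocks take disjoint intervals of values: `o` for the root, the next `size r` values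
  -- for the right subtree, the values above these for the left one. The `suc` is the shift to the
  -- 1-based values of `extend`.
  values-realizes : ∀ w T o a → (∀ {i} → i < size T → w (a + i) ≡ suc (values T o i)) → Realizes w T a
  values-realizes w leaf       o a h = leaf
  values-realizes w (node l r) o a h = node
    (λ i∈ → ≤-trans (≤-reflexive (cong suc w-root)) (≤-trans (s≤s (s≤s (m≤m+n o (size r)))) (w-left i∈)))
    (λ k∈ → ≤-trans (≤-reflexive (cong suc w-root)) (proj₁ (w-right k∈)))
    (λ i∈ k∈ → <-≤-trans (proj₂ (w-right k∈)) (w-left i∈))
    (values-realizes w l _ a h-left)
    (values-realizes w r _ _ h-right)
    where
    h-left : ∀ {i} → i < size l → w (a + i) ≡ suc (values l (suc (o + size r)) i)
    h-left i< = trans (h (≤-trans i< (m≤m+n _ _))) (cong suc (values-left l r o i<))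
    h-right : ∀ {i} → i < size r → w (suc (a + size l) + i) ≡ suc (values r (suc o) i)
    h-right {i} i< = trans
      (trans (cong w (trans (cong suc (+-assoc a (size l) i)) (sym (+-suc a _))))
        (h (subst (suc (size l + i) <_) (sym (+-suc (size l) (size r))) (s≤s (+-monoʳ-< (size l) i<)))))
      (cong suc (values-right l r o i))
    w-root : w (a + size l) ≡ suc o
    w-root = trans (h (m<m+n (size l) 0<1+n)) (cong suc (values-root l r o))
    relative : ∀ {b m i} → i ∈[ b ,+ m ⟩ → b + (i ∸ b) ≡ i × i ∸ b < m
    relative {b} {m} {i} (b≤i , i<) = m+[n∸m]≡n b≤i ,
      +-cancelˡ-< b _ _ (≤-trans (s≤s (≤-reflexive (m+[n∸m]≡n b≤i))) i<)
    w-left : ∀ {i} → i ∈[ a ,+ size l ⟩ → suc (suc (o + size r)) ≤ w i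
    w-left i∈ with eq , i< ← relative i∈ =
      ≤-trans (s≤s (proj₁ (values-range l _ i<))) (≤-reflexive (trans (sym (h-left i<)) (cong w eq)))
    w-right : ∀ {k} → k ∈[ suc (a + size l) ,+ size r ⟩ → suc (suc o) ≤ w k × w k < suc (suc (o + size r))
    w-right k∈ with eq , k< ← relative k∈ with weq ← trans (sym (h-right k<)) (cong w eq) =
      subst (suc (suc o) ≤_) weq (s≤s (proj₁ (values-range r _ k<))) ,
      subst (_< suc (suc (o + size r))) weq (s≤s (proj₂ (values-range r _ k<)))

  -- The smaller entry just after the segment plays the part of π(n+1) = 0, so the
  -- statistics of a subword are those of the whole word w restricted to its positions.
  adi-Realizes : ∀ {w T a} → Realizes w T a → (∀ {i} → i ∈[ a ,+ size T ⟩ → w (a + size T) < w i) →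
    Σ[ (λ i → Σ[ (λ j → ind (admissible? w i j)) ] a (size T)) ] a (size T) ≡ adiᵀ T
  adi-Realizes leaf _ = refl
  adi-Realizes {w} {node l r} {a} (node p<l p<r r<l L R) end = begin
    Σ[ (λ i → Σ[ f i ] a s) ] a s
      ≡⟨ Σ-split _ a (size l) (size r) ⟩
    Σ[ (λ i → Σ[ f i ] a s) ] a (size l) + (Σ[ f p ] a s + Σ[ (λ i → Σ[ f i ] a s) ] (suc p) (size r))
      ≡⟨ cong₂ _+_ (trans (Σ-cong a (size l) from-left) (Σ-+ _ _ a (size l)))
           (cong₂ _+_ (Σ-zero a s from-root) (Σ-cong (suc p) (size r) from-right)) ⟩
    Σ[ (λ i → Σ[ f i ] a (size l)) ] a (size l) + Σ[ (λ i → size r + [ size r >0]) ] a (size l)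
      + Σ[ (λ i → Σ[ f i ] (suc p) (size r)) ] (suc p) (size r)
      ≡⟨ cong₂ _+_ (cong₂ _+_ (adi-Realizes L p<l) (Σ-const _ a (size l)))
           (adi-Realizes R (λ {k} k∈ → subst (λ e → w e < w k) end≡ (end (range-right (size l) (size r) k∈)))) ⟩
    adiᵀ l + cross (size l) (size r) + adiᵀ r
      ≡⟨ +-assoc (adiᵀ l) _ _ ⟩
    adiᵀ l + (cross (size l) (size r) + adiᵀ r) ∎
    where
    open ≡-Reasoning
    s = size l + suc (size r)
    p = a + size l
    f = λ i j → ind (admissible? w i j)
    end≡ : a + s ≡ suc p + size r
    end≡ = trans (sym (+-assoc a (size l) _)) (+-suc p (size r))
    -- No entry between `i` and the root is below the root, so admissibility depends on the entry
    -- just after it: the first of the right block, which is larger, or the smaller entry past the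
    -- segment.
    last-root : ∀ m → m ≡ size r → ∀ {i} → i ∈[ a ,+ size l ⟩ → f i p ≡ [ m >0]
    last-root zero m≡ i∈ = ind-no (admissible? w _ p)
      λ { (_ , inj₁ lt) → <-asym lt (subst (λ e → w e < w p) (trans end≡ (trans (cong (suc p +_) (sym m≡)) (+-identityʳ _)))
                                      (end (range-middle (size l) (size r))))
        ; (_ , inj₂ (k , k<p , i<k , wk<wp)) → <-asym wk<wp (p<l (≤-trans (proj₁ i∈) (<⇒≤ i<k) , k<p)) }
    last-root (suc m) m≡ i∈ = ind-yes (admissible? w _ p)
      ((proj₂ i∈ , p<l i∈) , inj₁ (p<r (≤-refl , m<m+n (suc p) (subst (0 <_) m≡ 0<1+n))))
    left-right : ∀ {i j} → i ∈[ a ,+ size l ⟩ → j ∈[ suc p ,+ size r ⟩ → f i j ≡ 1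
    left-right i∈ j∈ = ind-yes (admissible? w _ _)
      ((<-trans (proj₂ i∈) (proj₁ j∈) , r<l i∈ j∈) , inj₂ (p , proj₁ j∈ , proj₂ i∈ , p<r j∈))
    from-left : ∀ {i} → i ∈[ a ,+ size l ⟩ → Σ[ f i ] a s ≡ Σ[ f i ] a (size l) + (size r + [ size r >0])
    from-left {i} i∈ = begin
      Σ[ f i ] a s
        ≡⟨ Σ-split _ a (size l) (size r) ⟩
      Σ[ f i ] a (size l) + (f i p + Σ[ f i ] (suc p) (size r))
        ≡⟨ cong (Σ[ f i ] a (size l) +_) (cong₂ _+_ (last-root (size r) refl i∈)
             (trans (Σ-constant 1 (suc p) (size r) (left-right i∈)) (*-identityʳ _))) ⟩
      Σ[ f i ] a (size l) + ([ size r >0] + size r)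
        ≡⟨ cong (Σ[ f i ] a (size l) +_) (+-comm [ size r >0] _) ⟩
      Σ[ f i ] a (size l) + (size r + [ size r >0]) ∎
    from-root : ∀ {j} → j ∈[ a ,+ s ⟩ → f p j ≡ 0
    from-root j∈ = ind-no (admissible? w p _) λ { ((p<j , wj<wp) , _) → helper p<j wj<wp (split-range a (size l) (size r) j∈) }
      where
      helper : ∀ {j} → p < j → w j < w p → ¬ (j ∈[ a ,+ size l ⟩ ⊎ j ≡ p ⊎ j ∈[ suc p ,+ size r ⟩)
      helper p<j _     (inj₁ (_ , j<p))  = <-asym p<j j<p
      helper p<j _     (inj₂ (inj₁ refl)) = <-irrefl refl p<j
      helper _   wj<wp (inj₂ (inj₂ j∈r)) = <-asym wj<wp (p<r j∈r)
    from-right : ∀ {i} → i ∈[ suc p ,+ size r ⟩ → Σ[ f i ] a s ≡ Σ[ f i ] (suc p) (size r)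
    from-right {i} i∈ = trans (Σ-split _ a (size l) (size r))
      (cong₂ _+_ (Σ-zero a (size l) λ j∈ → backwards (<-trans (proj₂ j∈) (proj₁ i∈)))
        (cong (_+ Σ[ f i ] (suc p) (size r)) (backwards (proj₁ i∈))))
      where
      backwards : ∀ {j} → j < i → f i j ≡ 0
      backwards j<i = ind-no (admissible? w i _) λ { ((i<j , _) , _) → <-asym i<j j<i }

  module _ {w : ℕ → ℕ} where

    private
      -- Decides whether the root is a descent bottom: its predecessor is the last entry of a
      -- nonempty left block, which is larger, or else the smaller entry at `b` before the segment.
      previous : ∀ l b → (∀ {i} → i ∈[ suc b ,+ size l ⟩ → w (suc b + size l) < w i) → w b < w (suc b + size l) →
        size l ≡ 0 × w (b + size l) < w (suc b + size l) ⊎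
        (∃ λ x → size l ≡ suc x) × w (suc b + size l) < w (b + size l)
      previous l b p<l b<p = helper (size l) p<l b<p
        where
        helper : ∀ m → (∀ {i} → i ∈[ suc b ,+ m ⟩ → w (suc b + m) < w i) → w b < w (suc b + m) →
          m ≡ 0 × w (b + m) < w (suc b + m) ⊎ (∃ λ x → m ≡ suc x) × w (suc b + m) < w (b + m)
        helper zero    p<l b<p = inj₁ (refl , subst (λ e → w e < w (suc b + 0)) (sym (+-identityʳ b)) b<p)
        helper (suc x) p<l b<p = inj₂ ((x , refl) , p<l
          (subst (suc b ≤_) (sym (+-suc b x)) (s≤s (m≤m+n b x)) , ≤-refl))

    -- Descents are counted at their bottoms, so the smaller entry preceding a segment creates none
    -- at its start. That entry is `w b` for the left block and the root for the right block.
    des-Realizes : ∀ {T b} → Realizes w T (suc b) → (∀ {i} → i ∈[ suc b ,+ size T ⟩ → w b < w i) →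
      Σ[ (λ i → ind (w i <? w (i ∸ 1))) ] (suc b) (size T) ≡ desᵀ T
    des-Realizes leaf _ = refl
    des-Realizes {node l r} {b} (node p<l p<r r<l L R) start = trans (Σ-split _ (suc b) (size l) (size r))
      (cong₂ _+_ (des-Realizes L (start ∘ range-left (size l) (size r)))
        (cong₂ _+_ (root (previous l b p<l (start (range-middle (size l) (size r))))) (des-Realizes R p<r)))
      where
      root : _ → ind (w (suc b + size l) <? w (b + size l)) ≡ [ size l >0]
      root (inj₁ (l≡0 , lt))       = trans (ind-no (_ <? _) (<-asym lt)) (cong [_>0] (sym l≡0))
      root (inj₂ ((_ , l≡) , lt)) = trans (ind-yes (_ <? _) lt) (cong [_>0] (sym l≡))

    -- Both neighbours of the segment stand for the boundary value 0. The root serves as right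
    -- neighbour of the left block and as left neighbour of the right block; it is itself a double
    -- descent exactly when it has a left child and no right one.
    dd-Realizes : ∀ {T b} → Realizes w T (suc b) → (∀ {i} → i ∈[ suc b ,+ size T ⟩ → w b < w i) →
      (∀ {i} → i ∈[ suc b ,+ size T ⟩ → w (suc b + size T) < w i) →
      Σ[ (λ i → ind ((w i <? w (i ∸ 1)) ×-dec (w (suc i) <? w i))) ] (suc b) (size T) ≡ ddᵀ T
    dd-Realizes leaf _ _ = refl
    dd-Realizes {node l r} {b} (node p<l p<r r<l L R) start end = trans (Σ-split _ (suc b) (size l) (size r))
      (cong₂ _+_ (dd-Realizes L (start ∘ range-left (size l) (size r)) p<l)
        (cong₂ _+_ (root (previous l b p<l (start (range-middle (size l) (size r)))) (size r) refl)
          (dd-Realizes R p<r λ {k} k∈ → subst (λ e → w e < w k) end≡ (end (range-right (size l) (size r) k∈)))))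
      where
      p = suc b + size l
      end≡ : suc b + (size l + suc (size r)) ≡ suc p + size r
      end≡ = trans (sym (+-assoc (suc b) (size l) _)) (+-suc p (size r))
      root? = (w p <? w (b + size l)) ×-dec (w (suc p) <? w p)
      root : _ → ∀ m → m ≡ size r → ind root? ≡ doubleDescent (size l) (size r)
      root (inj₁ (l≡0 , lt)) m m≡ =
        trans (ind-no root? λ { (gt , _) → <-asym lt gt }) (cong (λ x → doubleDescent x (size r)) (sym l≡0))
      root (inj₂ ((_ , l≡) , lt)) zero m≡ =
        trans (ind-yes root? (lt , subst (λ e → w e < w p)
            (trans end≡ (trans (cong (suc p +_) (sym m≡)) (+-identityʳ _)))
            (end (range-middle (size l) (size r)))))
          (cong₂ doubleDescent (sym l≡) m≡)
      root (inj₂ ((_ , l≡) , lt)) (suc m) m≡ =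
        trans (ind-no root? λ { (_ , gt) → <-asym gt (p<r (≤-refl , m<m+n (suc p) (subst (0 <_) m≡ 0<1+n))) })
          (cong₂ doubleDescent (sym l≡) m≡)

  -- Permutations and their trees

  extend-inside : ∀ s (π : Word n) (x : Fin n) → extend s π (suc (toℕ x)) ≡ suc (toℕ (lookup π x))
  extend-inside {n} s π x with toℕ x <? n
  ... | yes x<n = cong (suc ∘ toℕ ∘ lookup π) (Fin.fromℕ<-toℕ x x<n)
  ... | no  x≮n = contradiction (Fin.toℕ<n x) x≮n

  extend-end : ∀ s (π : Word n) → extend s π (suc n) ≡ s
  extend-end {n} s π with n <? n
  ... | yes n<n = contradiction n<n (<-irrefl refl)
  ... | no  _   = refl

  -- A view: matching on `at x` presents a position as `suc (toℕ x)`, the form in which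
  -- `extend-inside` evaluates `extend`.
  data Position {n : ℕ} : ℕ → Set where
    at : (x : Fin n) → Position (suc (toℕ x))

  position : ∀ {i} → i ∈[ 1 ,+ n ⟩ → Position {n} i
  position {n} {suc i} (_ , s≤s i<n) = subst (Position ∘ suc) (Fin.toℕ-fromℕ< i<n) (at (fromℕ< i<n))

  inside : (x : Fin n) → suc (toℕ x) ∈[ 1 ,+ n ⟩
  inside x = s≤s z≤n , s≤s (Fin.toℕ<n x)

  extend-positive : ∀ (π : Word n) {i} → i ∈[ 1 ,+ n ⟩ → 0 < extend 0 π i
  extend-positive π i∈ with at x ← position i∈ = subst (0 <_) (sym (extend-inside 0 π x)) 0<1+n

  lookup-ext : ∀ {A : Set} {m} {u v : Vec A m} → (∀ i → lookup u i ≡ lookup v i) → u ≡ v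
  lookup-ext {u = u} {v} h = trans (sym (tabulate∘lookup u)) (trans (tabulate-cong h) (tabulate∘lookup v))

  module _ (π : Word n) where
    private
      w = extend 0 π

    extend-< : ∀ {x y} → lookup π x Fin.< lookup π y → w (suc (toℕ x)) < w (suc (toℕ y))
    extend-< {x} {y} lt = subst₂ _<_ (sym (extend-inside 0 π x)) (sym (extend-inside 0 π y)) (s≤s lt)

    extend-<⁻ : ∀ {x y} → w (suc (toℕ x)) < w (suc (toℕ y)) → lookup π x Fin.< lookup π y
    extend-<⁻ {x} {y} lt = ≤-pred (subst₂ _<_ (extend-inside 0 π x) (extend-inside 0 π y) lt)

    IsPermutation⇒InjectiveOn : IsPermutation π → InjectiveOn w 1 n
    IsPermutation⇒InjectiveOn perm i∈ j∈ eq with at x ← position i∈ | at y ← position j∈ =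
      cong (suc ∘ toℕ) (perm (Fin.toℕ-injective (suc-injective
        (trans (sym (extend-inside 0 π x)) (trans eq (extend-inside 0 π y))))))

    InjectiveOn⇒IsPermutation : InjectiveOn w 1 n → IsPermutation π
    InjectiveOn⇒IsPermutation inj {x} {y} eq = Fin.toℕ-injective (suc-injective (inj (inside x) (inside y)
      (trans (extend-inside 0 π x) (trans (cong (suc ∘ toℕ) eq) (sym (extend-inside 0 π y))))))

    contains213 : ∀ {i j k} → i Fin.< j → j Fin.< k →
      lookup π j Fin.< lookup π i → lookup π i Fin.< lookup π k → Contains τ213 π
    contains213 {i} {j} {k} i<j j<k πj<πi πi<πk = i ∷ j ∷ k ∷ [] , increasing , same-order
      where
      πj<πk = <-trans πj<πi πi<πk
      p = i ∷ j ∷ k ∷ []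
      increasing : ∀ x y → x Fin.< y → lookup p x Fin.< lookup p y
      increasing zero zero ()
      increasing zero (suc zero) _ = i<j
      increasing zero (suc (suc zero)) _ = <-trans i<j j<k
      increasing (suc zero) zero ()
      increasing (suc zero) (suc zero) (s≤s ())
      increasing (suc zero) (suc (suc zero)) _ = j<k
      increasing (suc (suc zero)) zero ()
      increasing (suc (suc zero)) (suc zero) (s≤s ())
      increasing (suc (suc zero)) (suc (suc zero)) (s≤s (s≤s ()))
      up : ∀ {a b c d} → a < b → c < d → (a < b → c < d) × (c < d → a < b)
      up a<b c<d = (λ _ → c<d) , (λ _ → a<b)
      down : ∀ {a b c d} → b ≤ a → d ≤ c → (a < b → c < d) × (c < d → a < b)
      down b≤a d≤c = (λ a<b → contradiction b≤a (<⇒≱ a<b)) , (λ c<d → contradiction d≤c (<⇒≱ c<d))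
      same-order : ∀ x y →
        (lookup τ213 x Fin.< lookup τ213 y → lookup π (lookup p x) Fin.< lookup π (lookup p y)) ×
        (lookup π (lookup p x) Fin.< lookup π (lookup p y) → lookup τ213 x Fin.< lookup τ213 y)
      same-order zero zero = down ≤-refl ≤-refl
      same-order zero (suc zero) = down z≤n (<⇒≤ πj<πi)
      same-order zero (suc (suc zero)) = up ≤-refl πi<πk
      same-order (suc zero) zero = up ≤-refl πj<πi
      same-order (suc zero) (suc zero) = down ≤-refl ≤-refl
      same-order (suc zero) (suc (suc zero)) = up (s≤s z≤n) πj<πk
      same-order (suc (suc zero)) zero = down (s≤s z≤n) (<⇒≤ πi<πk)
      same-order (suc (suc zero)) (suc zero) = down z≤n (<⇒≤ πj<πk)
      same-order (suc (suc zero)) (suc (suc zero)) = down ≤-refl ≤-refl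

    ¬Contains⇒Avoids213On : ¬ Contains τ213 π → Avoids213On w 1 n
    ¬Contains⇒Avoids213On avoids i∈ j∈ k∈ i<j j<k (wj<wi , wi<wk)
      with at x ← position i∈ | at y ← position j∈ | at z ← position k∈ =
      avoids (contains213 (≤-pred i<j) (≤-pred j<k) (extend-<⁻ wj<wi) (extend-<⁻ wi<wk))

    Avoids213On⇒¬Contains : Avoids213On w 1 n → ¬ Contains τ213 π
    Avoids213On⇒¬Contains av (x ∷ y ∷ z ∷ [] , increasing , same-order) =
      av (inside x) (inside y) (inside z)
        (s≤s (increasing zero (suc zero) (s≤s z≤n)))
        (s≤s (increasing (suc zero) (suc (suc zero)) (s≤s (s≤s z≤n))))
        ( extend-< (proj₁ (same-order (suc zero) zero) (s≤s z≤n))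
        , extend-< (proj₁ (same-order zero (suc (suc zero))) (s≤s (s≤s z≤n))))

    -- Passes from the tops 1, ..., n-1 of descents to their bottoms 2, ..., n. The added term at 1
    -- is 0 because `w 0` is 0.
    des-Σ : des π ≡ Σ[ (λ i → ind (w i <? w (i ∸ 1))) ] 1 n
    des-Σ = trans (count-[1⋯] _ (n ∸ 1)) (helper n refl)
      where
      f = λ i → ind (w i <? w (i ∸ 1))
      helper : ∀ m → m ≡ n → Σ[ f ∘ suc ] 1 (m ∸ 1) ≡ Σ[ f ] 1 m
      helper zero    _  = refl
      helper (suc m) _ = trans (sym (Σ-shift f 1 m))
        (cong (_+ Σ[ f ] 2 m) (sym (ind-no (w 1 <? 0) λ ())))

  Tree-of : Word n → Tree → Set
  Tree-of {n} π T = IsPermutation π × size T ≡ n × Realizes (extend 0 π) T 1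

  tree : (π : Word n) → IsAvoidingPermutation τ213 π → ∃ (Tree-of π)
  tree {n} π (perm , avoids)
    with T , size≡ , R ← realize n (extend 0 π) 1 n ≤-refl
           (IsPermutation⇒InjectiveOn π perm) (¬Contains⇒Avoids213On π avoids)
    = T , perm , size≡ , R

  Tree-of⇒avoiding : ∀ {π : Word n} {T} → Tree-of π T → IsAvoidingPermutation τ213 π
  Tree-of⇒avoiding {π = π} (perm , refl , R) = perm , Avoids213On⇒¬Contains π (Realizes⇒Avoids213On R)

  word : ∀ T → size T ≡ n → ∃ λ (π : Word n) → Tree-of π T
  word T refl = π , InjectiveOn⇒IsPermutation π (Realizes⇒InjectiveOn R) , refl , R
    where
    value< : (x : Fin (size T)) → values T 0 (toℕ x) < size T
    value< x = proj₂ (values-range T 0 (Fin.toℕ<n x))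
    π : Word (size T)
    π = tabulate λ x → fromℕ< (value< x)
    R : Realizes (extend 0 π) T 1
    R = values-realizes (extend 0 π) T 0 1 λ {i} i< → begin
      extend 0 π (suc i)                                  ≡⟨ cong (extend 0 π ∘ suc) (Fin.toℕ-fromℕ< i<) ⟨
      extend 0 π (suc (toℕ (fromℕ< i<)))                  ≡⟨ extend-inside 0 π (fromℕ< i<) ⟩
      suc (toℕ (lookup π (fromℕ< i<)))                    ≡⟨ cong (suc ∘ toℕ) (lookup∘tabulate _ (fromℕ< i<)) ⟩
      suc (toℕ (fromℕ< (value< (fromℕ< i<))))             ≡⟨ cong suc (Fin.toℕ-fromℕ< _) ⟩
      suc (values T 0 (toℕ (fromℕ< i<)))                  ≡⟨ cong (suc ∘ values T 0) (Fin.toℕ-fromℕ< i<) ⟩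
      suc (values T 0 i)                                  ∎
      where open ≡-Reasoning

  -- If `y` were missed, punching it out would inject `Fin (suc n)` into `Fin n`.
  injective⇒surjective : {f : Fin n → Fin n} → Injective _≡_ _≡_ f → ∀ y → ∃ λ x → f x ≡ y
  injective⇒surjective {suc n} {f} inj y with Fin.any? (λ x → f x Fin.≟ y)
  ... | yes hit  = hit
  ... | no  miss = contradiction
    (Fin.injective⇒≤ {f = λ x → Fin.punchOut (avoid x)} λ {x} {x′} eq →
      inj (Fin.punchOut-injective (avoid x) (avoid x′) eq))
    (<⇒≱ ≤-refl)
    where
    avoid : ∀ x → y ≢ f x
    avoid x eq = miss (x , sym eq)

  -- The map `f` = π′ ∘ π⁻¹ is strictly increasing on `Fin n`, and a strictly increasing self-map
  -- lies above the identity. Used in both directions, this shows that two permutations with the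
  -- same relative order are equal.
  order⇒≤ : ∀ {π π′ : Word n} → IsPermutation π →
    (∀ {x y} → lookup π x Fin.< lookup π y → lookup π′ x Fin.< lookup π′ y) →
    ∀ x → lookup π x Fin.≤ lookup π′ x
  order⇒≤ {n} {π} {π′} perm mono x =
    -- With `v` the value of π at `x`, the pigeonhole principle gives some `y` below or at `v` with
    -- `f y` at least `v`; monotonicity replaces `f y` by `f v`, which is the value of π′ at `x`.
    let y , y≤v , v≤fy = Fin.injective⇒existsPivot f-injective (lookup π x)
    in ≤-trans v≤fy (≤-trans (f-mono y≤v) (≤-reflexive (cong (toℕ ∘ lookup π′) (perm (π∘π⁻¹ _)))))
    where
    π⁻¹ : Fin n → Fin n
    π⁻¹ v = proj₁ (injective⇒surjective perm v)
    π∘π⁻¹ : ∀ v → lookup π (π⁻¹ v) ≡ v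
    π∘π⁻¹ v = proj₂ (injective⇒surjective perm v)
    f : Fin n → Fin n
    f v = lookup π′ (π⁻¹ v)
    f-strict : ∀ {u v} → u Fin.< v → f u Fin.< f v
    f-strict {u} {v} u<v = mono (subst₂ Fin._<_ (sym (π∘π⁻¹ u)) (sym (π∘π⁻¹ v)) u<v)
    f-mono : ∀ {u v} → u Fin.≤ v → f u Fin.≤ f v
    f-mono u≤v with m≤n⇒m<n∨m≡n u≤v
    ... | inj₁ u<v = <⇒≤ (f-strict u<v)
    ... | inj₂ u≡v = ≤-reflexive (cong (toℕ ∘ f) (Fin.toℕ-injective u≡v))
    f-injective : Injective _≡_ _≡_ f
    f-injective {u} {v} eq with Fin.<-cmp u v
    ... | tri< u<v _ _ = contradiction (cong toℕ eq) (<⇒≢ (f-strict u<v))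
    ... | tri≈ _ u≡v _ = u≡v
    ... | tri> _ _ v<u = contradiction (cong toℕ (sym eq)) (<⇒≢ (f-strict v<u))

  Tree-of-functional : ∀ {π : Word n} {T T′} → Tree-of π T → Tree-of π T′ → T ≡ T′
  Tree-of-functional (_ , s , R) (_ , s′ , R′) = tree-unique R R′ (trans s (sym s′))

  Tree-of-injective : ∀ {π π′ : Word n} {T} → Tree-of π T → Tree-of π′ T → π ≡ π′
  Tree-of-injective {π = π} {π′} (perm , refl , R) (perm′ , _ , R′) = lookup-ext λ x →
    Fin.≤-antisym
      (order⇒≤ {π = π} {π′} perm (λ {x} {y} → extend-<⁻ π′ ∘ order-determined R R′ (inside x) (inside y) ∘ extend-< π) x)
      (order⇒≤ {π = π′} {π} perm′ (λ {x} {y} → extend-<⁻ π ∘ order-determined R′ R (inside x) (inside y) ∘ extend-< π′) x)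

  module _ {π : Word n} {T : Tree} where
    private
      w = extend 0 π

    des≡desᵀ : Tree-of π T → des π ≡ desᵀ T
    des≡desᵀ (_ , refl , R) = trans (des-Σ π) (des-Realizes R (extend-positive π))

    dd≡ddᵀ : Tree-of π T → dd π ≡ ddᵀ T
    dd≡ddᵀ (_ , refl , R) = trans (count-[1⋯] _ n) (dd-Realizes R (extend-positive π)
      λ {i} i∈ → subst (_< w i) (sym (extend-end 0 π)) (extend-positive π i∈))

    adi≡adiᵀ : Tree-of π T → adi π ≡ adiᵀ T
    adi≡adiᵀ (_ , refl , R) = trans (count-[1⋯]² (admissible? w) n) (adi-Realizes R
      λ {i} i∈ → subst (_< w i) (sym (extend-end 0 π)) (extend-positive π i∈))

  -- Reverse-complement

  opposite-< : {x y : Fin n} → x Fin.< y → opposite y Fin.< opposite x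
  opposite-< {n} {x} {y} x<y = subst₂ _<_ (sym (Fin.opposite-prop y)) (sym (Fin.opposite-prop x))
    (∸-monoʳ-< (s≤s x<y) (Fin.toℕ<n y))

  opposite-<⁻ : {x y : Fin n} → opposite y Fin.< opposite x → x Fin.< y
  opposite-<⁻ {x = x} {y} lt = subst₂ Fin._<_ (Fin.opposite-involutive x) (Fin.opposite-involutive y) (opposite-< lt)

  rc : Vec (Fin n) k → Vec (Fin n) k
  rc v = tabulate λ x → opposite (lookup v (opposite x))

  lookup-rc : (v : Vec (Fin n) k) → ∀ x → lookup (rc v) x ≡ opposite (lookup v (opposite x))
  lookup-rc v = lookup∘tabulate _

  lookup-rc-opposite : (v : Vec (Fin n) k) → ∀ x → lookup (rc v) (opposite x) ≡ opposite (lookup v x)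
  lookup-rc-opposite v x = trans (lookup-rc v (opposite x)) (cong (opposite ∘ lookup v) (Fin.opposite-involutive x))

  rc-involutive : (v : Vec (Fin n) k) → rc (rc v) ≡ v
  rc-involutive v = lookup-ext λ x → trans (lookup-rc (rc v) x)
    (trans (cong opposite (lookup-rc-opposite v x)) (Fin.opposite-involutive _))

  opposite-injective : {x y : Fin n} → opposite x ≡ opposite y → x ≡ y
  opposite-injective {x = x} {y} eq =
    trans (sym (Fin.opposite-involutive x)) (trans (cong opposite eq) (Fin.opposite-involutive y))

  rc-IsPermutation : (π : Word n) → IsPermutation π → IsPermutation (rc π)
  rc-IsPermutation π perm {x} {y} eq = opposite-injective (perm (opposite-injective
    (trans (sym (lookup-rc π x)) (trans eq (lookup-rc π y)))))

  -- The positions of the occurrence are reflected and listed backwards, which is `rc` applied to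
  -- the vector of positions.
  rc-Contains : (τ : Word k) (π : Word n) → Contains τ (rc π) → Contains (rc τ) π
  rc-Contains τ π (p , increasing , same-order) = rc p ,
    (λ x y x<y → subst₂ Fin._<_ (sym (lookup-rc p x)) (sym (lookup-rc p y))
       (opposite-< (increasing _ _ (opposite-< x<y)))) ,
    (λ x y →
      (λ lt → subst₂ Fin._<_ (sym (π∘p x)) (sym (π∘p y)) (opposite-<
         (proj₁ (same-order (opposite y) (opposite x)) (opposite-<⁻ (subst₂ Fin._<_ (lookup-rc τ x) (lookup-rc τ y) lt))))) ,
      (λ lt → subst₂ Fin._<_ (sym (lookup-rc τ x)) (sym (lookup-rc τ y)) (opposite-<
         (proj₂ (same-order (opposite y) (opposite x)) (opposite-<⁻ (subst₂ Fin._<_ (π∘p x) (π∘p y) lt))))))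
    where
    π∘p : ∀ x → lookup π (lookup (rc p) x) ≡ opposite (lookup (rc π) (lookup p (opposite x)))
    π∘p x = trans (cong (lookup π) (lookup-rc p x))
      (trans (sym (Fin.opposite-involutive _)) (cong opposite (sym (lookup-rc π _))))

  rc-avoiding : (τ : Word k) (π : Word n) → IsAvoidingPermutation (rc τ) π → IsAvoidingPermutation τ (rc π)
  rc-avoiding τ π (perm , avoids) = rc-IsPermutation π perm , avoids ∘ rc-Contains τ π

  module _ (π : Word n) where
    private
      N  = suc n
      w  = extend 0 π
      w′ = extend N (rc π)

    extend≤ : ∀ {i} → i ≤ N → w i ≤ N
    extend≤ {zero}  _ = z≤n
    extend≤ {suc i} (s≤s i≤n) with m≤n⇒m<n∨m≡n i≤n
    ... | inj₂ refl = subst (_≤ N) (sym (extend-end 0 π)) z≤n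
    ... | inj₁ i<n with at x ← position (s≤s (z≤n {i}) , s≤s i<n) =
      subst (_≤ N) (sym (extend-inside 0 π x)) (<⇒≤ (s≤s (Fin.toℕ<n _)))

    -- Valid at the ends 0 and `N` as well: reflection swaps them, and complementation turns the
    -- boundary value 0 into n+1. This is how the starred conventions arise from the unstarred ones.
    extend-rc : ∀ {i} → i ≤ N → w′ i ≡ N ∸ w (N ∸ i)
    extend-rc {zero}  _ = sym (cong (N ∸_) (extend-end 0 π))
    extend-rc {suc i} (s≤s i≤n) with m≤n⇒m<n∨m≡n i≤n
    ... | inj₂ refl = trans (extend-end N (rc π)) (sym (cong (λ e → N ∸ w e) (n∸n≡0 n)))
    ... | inj₁ i<n with at x ← position (s≤s (z≤n {i}) , s≤s i<n) = begin
      w′ (suc (toℕ x))                               ≡⟨ extend-inside N (rc π) x ⟩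
      suc (toℕ (lookup (rc π) x))                    ≡⟨ cong (suc ∘ toℕ) (lookup-rc π x) ⟩
      suc (toℕ (opposite (lookup π (opposite x))))   ≡⟨ opposite-suc _ ⟩
      N ∸ suc (toℕ (lookup π (opposite x)))          ≡⟨ cong (N ∸_) (extend-inside 0 π (opposite x)) ⟨
      N ∸ w (suc (toℕ (opposite x)))                 ≡⟨ cong (λ e → N ∸ w e) (opposite-suc x) ⟩
      N ∸ w (N ∸ suc (toℕ x))                        ∎
      where
      open ≡-Reasoning
      opposite-suc : (y : Fin n) → suc (toℕ (opposite y)) ≡ N ∸ suc (toℕ y)
      opposite-suc y = trans (cong suc (Fin.opposite-prop y)) (sym (+-∸-assoc 1 (Fin.toℕ<n y)))

    rc-< : ∀ {i j} → i ≤ N → j ≤ N → w (N ∸ j) < w (N ∸ i) → w′ i < w′ j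
    rc-< {i} {j} i≤ j≤ lt = subst₂ _<_ (sym (extend-rc i≤)) (sym (extend-rc j≤)) (∸-monoʳ-< lt (extend≤ (m∸n≤m N i)))

    rc-<⁻ : ∀ {i j} → i ≤ N → j ≤ N → w′ i < w′ j → w (N ∸ j) < w (N ∸ i)
    rc-<⁻ {i} {j} i≤ j≤ lt = ∸-cancelʳ-< {o = N} (subst₂ _<_ (extend-rc i≤) (extend-rc j≤) lt)

    private
      reflect-pred : ∀ {i} → i ∈[ 1 ,+ n ⟩ → N ∸ (i ∸ 1) ≡ suc (N ∸ i)
      reflect-pred {suc i} (_ , s≤s i<n) = +-∸-assoc 1 (<⇒≤ i<n)

      reflect-suc : ∀ i → N ∸ suc i ≡ N ∸ i ∸ 1
      reflect-suc i = trans (cong (N ∸_) (+-comm 1 i)) (sym (∸-+-assoc N i 1))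

      reflect-< : ∀ {i j} → j ≤ N → i < j → N ∸ j < N ∸ i
      reflect-< j≤ i<j = ∸-monoʳ-< i<j j≤

      pred≤ : ∀ {i} → i ≤ N → i ∸ 1 ≤ N
      pred≤ {i} = ≤-trans (m∸n≤m i 1)

      ≤N : ∀ {i} → i ∈[ 1 ,+ n ⟩ → i ≤ N
      ≤N (_ , i<N) = <⇒≤ i<N

    -- Reflection exchanges the two members of a pair: an ascent into the first becomes an ascent
    -- out of the second, and an intermediate entry above the first becomes one below the second.
    StarAdmissible⇒Admissible : ∀ {i j} → i ∈[ 1 ,+ n ⟩ → j ∈[ 1 ,+ n ⟩ →
      StarAdmissible w′ i j → Admissible w (N ∸ j) (N ∸ i)
    StarAdmissible⇒Admissible {i} {j} i∈ j∈ ((i<j , inv) , why) =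
      (reflect-< (≤N j∈) i<j , rc-<⁻ (≤N j∈) (≤N i∈) inv) , reason why
      where
      reason : _ → _
      reason (inj₁ asc) = inj₁ (subst (λ e → w (N ∸ i) < w e) (reflect-pred i∈) (rc-<⁻ (pred≤ (≤N i∈)) (≤N i∈) asc))
      reason (inj₂ (l , l<j , i<l , lt)) = let l≤N = ≤-trans (<⇒≤ l<j) (≤N j∈) in
        inj₂ (N ∸ l , reflect-< l≤N i<l , reflect-< (≤N j∈) l<j , rc-<⁻ (≤N i∈) l≤N lt)

    Admissible⇒StarAdmissible : ∀ {i j} → i ∈[ 1 ,+ n ⟩ → j ∈[ 1 ,+ n ⟩ →
      Admissible w (N ∸ j) (N ∸ i) → StarAdmissible w′ i j
    Admissible⇒StarAdmissible {i} {j} i∈ j∈ ((i<j , inv) , why) =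
      (∸-cancelʳ-< {o = N} i<j , rc-< (≤N j∈) (≤N i∈) inv) , reason why
      where
      reason : _ → _
      reason (inj₁ asc) = inj₁ (rc-< (pred≤ (≤N i∈)) (≤N i∈) (subst (λ e → w (N ∸ i) < w e) (sym (reflect-pred i∈)) asc))
      reason (inj₂ (l , l< , <l , lt)) =
        inj₂ (N ∸ l , subst (N ∸ l <_) (m∸[m∸n]≡n (≤N j∈)) (reflect-< l≤N <l)
                    , subst (_< N ∸ l) (m∸[m∸n]≡n (≤N i∈)) (reflect-< (m∸n≤m N i) l<)
                    , rc-< (≤N i∈) (m∸n≤m N l) (subst (λ e → w e < w (N ∸ i)) (sym (m∸[m∸n]≡n l≤N)) lt))
        where
        l≤N : l ≤ N
        l≤N = ≤-trans (<⇒≤ l<) (m∸n≤m N i)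

    -- The pair `(i , j)` corresponds to `(N ∸ j , N ∸ i)`, so each index is reversed and then the
    -- two summations are exchanged.
    adi*-rc : adi* (rc π) ≡ adi π
    adi*-rc = begin
      adi* (rc π)
        ≡⟨ count-[1⋯]² (starAdmissible? w′) n ⟩
      Σ[ (λ i → Σ[ (λ j → ind (starAdmissible? w′ i j)) ] 1 n) ] 1 n
        ≡⟨ (Σ-cong 1 n λ {i} i∈ → Σ-cong 1 n λ {j} j∈ → ind-cong (starAdmissible? w′ i j) (admissible? w (N ∸ j) (N ∸ i))
              (StarAdmissible⇒Admissible i∈ j∈) (Admissible⇒StarAdmissible i∈ j∈)) ⟩
      Σ[ (λ i → Σ[ (λ j → f (N ∸ j) (N ∸ i)) ] 1 n) ] 1 n
        ≡⟨ (Σ-cong 1 n λ {i} _ → Σ-reverse (λ j → f j (N ∸ i)) n) ⟨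
      Σ[ (λ i → Σ[ (λ j → f j (N ∸ i)) ] 1 n) ] 1 n
        ≡⟨ Σ-reverse (λ i → Σ[ (λ j → f j i) ] 1 n) n ⟨
      Σ[ (λ i → Σ[ (λ j → f j i) ] 1 n) ] 1 n
        ≡⟨ Σ-swap f 1 n 1 n ⟨
      Σ[ (λ i → Σ[ f i ] 1 n) ] 1 n
        ≡⟨ count-[1⋯]² (admissible? w) n ⟨
      adi π ∎
      where
      open ≡-Reasoning
      f = λ i j → ind (admissible? w i j)

    dd*-rc : dd* (rc π) ≡ dd π
    dd*-rc = begin
      dd* (rc π)                                                          ≡⟨ count-[1⋯] _ n ⟩
      Σ[ (λ i → ind (dd*? i)) ] 1 n                                       ≡⟨ Σ-cong 1 n reflect ⟩
      Σ[ (λ i → ind (dd? (N ∸ i))) ] 1 n                                  ≡⟨ Σ-reverse (λ i → ind (dd? i)) n ⟨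
      Σ[ (λ i → ind (dd? i)) ] 1 n                                        ≡⟨ count-[1⋯] _ n ⟨
      dd π                                                                ∎
      where
      open ≡-Reasoning
      dd*? = λ i → (w′ i <? w′ (i ∸ 1)) ×-dec (w′ (suc i) <? w′ i)
      dd?  = λ i → (w i <? w (i ∸ 1)) ×-dec (w (suc i) <? w i)
      reflect : ∀ {i} → i ∈[ 1 ,+ n ⟩ → ind (dd*? i) ≡ ind (dd? (N ∸ i))
      reflect {i} i∈ = ind-cong (dd*? i) (dd? (N ∸ i))
        (λ { (d , d′) → subst (λ e → w (N ∸ i) < w e) (reflect-suc i) (rc-<⁻ (proj₂ i∈) (≤N i∈) d′)
                      , subst (λ e → w e < w (N ∸ i)) (reflect-pred i∈) (rc-<⁻ (≤N i∈) (pred≤ (≤N i∈)) d) })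
        (λ { (d , d′) → rc-< (≤N i∈) (pred≤ (≤N i∈)) (subst (λ e → w e < w (N ∸ i)) (sym (reflect-pred i∈)) d′)
                      , rc-< (proj₂ i∈) (≤N i∈) (subst (λ e → w (N ∸ i) < w e) (sym (reflect-suc i)) d) })

  extend-boundary : ∀ s s′ (π : Word n) {i} → i ∈[ 1 ,+ n ⟩ → extend s π i ≡ extend s′ π i
  extend-boundary s s′ π i∈ with at x ← position i∈ = trans (extend-inside s π x) (sym (extend-inside s′ π x))

  -- The adjacent pair starting at `i` goes to the one starting at `suc m ∸ i`. `rc-<` speaks of the
  -- boundary value `N` and `des` of 0; `extend-boundary` mediates at the positions 1, ..., n.
  des-rc : (π : Word n) → des (rc π) ≡ des π
  des-rc {zero}  π = refl
  des-rc {suc m} π = begin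
    des (rc π)                                                 ≡⟨ count-[1⋯] _ m ⟩
    Σ[ (λ i → ind (u (suc i) <? u i)) ] 1 m                    ≡⟨ Σ-cong 1 m reflect ⟩
    Σ[ (λ i → ind (w (suc (suc m ∸ i)) <? w (suc m ∸ i))) ] 1 m ≡⟨ Σ-reverse (λ i → ind (w (suc i) <? w i)) m ⟨
    Σ[ (λ i → ind (w (suc i) <? w i)) ] 1 m                    ≡⟨ count-[1⋯] _ m ⟨
    des π                                                      ∎
    where
    open ≡-Reasoning
    N = suc (suc m)
    w = extend 0 π
    u = extend 0 (rc π)
    reflect : ∀ {i} → i ∈[ 1 ,+ m ⟩ → ind (u (suc i) <? u i) ≡ ind (w (suc (suc m ∸ i)) <? w (suc m ∸ i))
    reflect {i} (1≤i , i≤m) = ind-cong (_ <? _) (_ <? _)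
      (subst (λ e → w e < w (suc m ∸ i)) eq ∘ rc-<⁻ π suc-i≤N i≤N ∘
        subst₂ _<_ (extend-boundary 0 N (rc π) suc-i∈) (extend-boundary 0 N (rc π) i∈))
      (subst₂ _<_ (extend-boundary N 0 (rc π) suc-i∈) (extend-boundary N 0 (rc π) i∈) ∘
        rc-< π suc-i≤N i≤N ∘ subst (λ e → w e < w (suc m ∸ i)) (sym eq))
      where
      i∈ : i ∈[ 1 ,+ suc m ⟩
      i∈ = 1≤i , m≤n⇒m≤1+n i≤m
      suc-i∈ : suc i ∈[ 1 ,+ suc m ⟩
      suc-i∈ = s≤s z≤n , s≤s i≤m
      i≤N : i ≤ N
      i≤N = <⇒≤ (proj₂ i∈)
      suc-i≤N : suc i ≤ N
      suc-i≤N = proj₂ i∈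
      eq : N ∸ i ≡ suc (suc m ∸ i)
      eq = +-∸-assoc 1 (<⇒≤ i≤m)

  -- Enumeration of trees and permutations

  joins : (ℕ → List Tree) → ℕ → ℕ → List Tree
  joins ts n i = cartesianProductWith node (ts i) (ts (n ∸ i))

  -- The trees of size n and height at most f.  The bound f makes the recursion structural.
  trees : ℕ → ℕ → List Tree
  trees _       zero    = leaf ∷ []
  trees zero    (suc n) = []
  trees (suc f) (suc n) = concatMap (joins (trees f) n) (upTo (suc n))

  size-trees : ∀ f n {T} → T ∈ trees f n → size T ≡ n
  size-trees f       zero    (here refl) = refl
  size-trees (suc f) (suc n) T∈
    with i , i∈ , T∈′ ← find (∈-concatMap⁻ (joins (trees f) n) {upTo (suc n)} T∈)
    with l , r , l∈ , r∈ , refl ← ∈-cartesianProductWith⁻ node (trees f i) (trees f (n ∸ i)) T∈′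
    = trans (+-suc (size l) (size r)) (cong suc
        (trans (cong₂ _+_ (size-trees f i l∈) (size-trees f (n ∸ i) r∈)) (m+[n∸m]≡n (≤-pred (∈-upTo⁻ i∈)))))

  ∈-trees : ∀ f T → size T ≤ f → T ∈ trees f (size T)
  ∈-trees f       leaf       _ = here refl
  ∈-trees zero    (node l r) h = contradiction (≤-trans (m≤n+m (suc (size r)) (size l)) h) λ ()
  ∈-trees (suc f) (node l r) h rewrite +-suc (size l) (size r) =
    ∈-concatMap⁺ (joins (trees f) (size l + size r))
      (lose (∈-upTo⁺ (s≤s (m≤m+n (size l) (size r))))
        (∈-cartesianProductWith⁺ node
          (∈-trees f l (≤-trans (m≤m+n _ _) (≤-pred h)))
          (subst (λ m → r ∈ trees f m) (sym (m+n∸m≡n (size l) (size r)))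
            (∈-trees f r (≤-trans (m≤n+m _ _) (≤-pred h))))))

  -- The lists joined for different `i` are disjoint, since `i` is the size of the left subtree.
  trees-unique : ∀ f n → Unique (trees f n)
  trees-unique f       zero    = All.[] ∷ []
  trees-unique zero    (suc n) = []
  trees-unique (suc f) (suc n) = Unique.concat⁺ {xss = map (joins (trees f) n) (upTo (suc n))}
    (All.map⁺ {f = joins (trees f) n} (All.tabulate {xs = upTo (suc n)} λ {i} _ → Unique.cartesianProductWith⁺ node (λ { refl → refl , refl })
      (trees-unique f i) (trees-unique f (n ∸ i))))
    (AllPairs.map⁺ (AllPairs.map (λ i≢j {_} → disjoint i≢j) (Unique.upTo⁺ (suc n))))
    where
    left-size : ∀ i {T : Tree} → T ∈ joins (trees f) n i →
                ∃₂ λ l r → T ≡ Tree.node l r × size l ≡ i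
    left-size i T∈ with l , r , l∈ , _ , eq ← ∈-cartesianProductWith⁻ node (trees f i) (trees f (n ∸ i)) T∈ =
      l , r , eq , size-trees f i l∈
    disjoint : ∀ {i j} → i ≢ j → Disjoint (joins (trees f) n i)
                                          (joins (trees f) n j)
    disjoint {i} {j} i≢j (T∈i , T∈j) with left-size i T∈i | left-size j T∈j
    ... | l , r , refl , refl | _ , _ , refl , refl = i≢j refl

  words-complete : ∀ {n k} (v : Vec _ k) → v ∈ words n k
  words-complete []      = here refl
  words-complete (x ∷ v) = ∈-cartesianProductWith⁺ _∷_ (∈-allFin x) (words-complete v)

  words-unique : ∀ n k → Unique (words n k)
  words-unique n zero    = All.[] ∷ []
  words-unique n (suc k) = Unique.cartesianProductWith⁺ _∷_ ∷-injective (Unique.allFin⁺ n) (words-unique n k)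

  module _ {k n : ℕ} (τ : Word k) where

    𝔖-unique : Unique (𝔖 n τ)
    𝔖-unique = Unique.filter⁺ (isAvoidingPermutation? τ) (words-unique n n)

    ∈-𝔖⁺ : ∀ {π} → IsAvoidingPermutation τ π → π ∈ 𝔖 n τ
    ∈-𝔖⁺ {π} = ∈-filter⁺ (isAvoidingPermutation? τ) (words-complete π)

    ∈-𝔖⁻ : ∀ {π} → π ∈ 𝔖 n τ → IsAvoidingPermutation τ π
    ∈-𝔖⁻ π∈ = proj₂ (∈-filter⁻ (isAvoidingPermutation? τ) {xs = words n n} π∈)

  -- Counting the right-only nodes of a tree without double descents

  rightOnly : ℕ → ℕ → ℕ
  rightOnly zero (suc _) = 1
  rightOnly _    _       = 0

  rightOnlyᵀ : Tree → ℕ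
  rightOnlyᵀ leaf       = 0
  rightOnlyᵀ (node l r) = rightOnlyᵀ l + (rightOnly (size l) (size r) + rightOnlyᵀ r)

  children-count : ∀ i j → doubleDescent i j ≡ 0 → [ i >0] + rightOnly i j ≡ [ j >0]
  children-count zero    zero    _ = refl
  children-count zero    (suc j) _ = refl
  children-count (suc i) (suc j) _ = refl

  -- Every node but the root is a left or a right child. There are `desᵀ T` left children and, by
  -- `children-count`, `desᵀ T + rightOnlyᵀ T` right children; `[ size T >0]` stands for the root.
  node-count : ∀ T → ddᵀ T ≡ 0 → 2 * desᵀ T + rightOnlyᵀ T + [ size T >0] ≡ size T
  node-count leaf       _  = refl
  node-count (node l r) dd≡0 = begin
    2 * (dl + (pi + dr)) + (ul + (x + ur)) + [ i + suc j >0]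
      ≡⟨ cong (λ e → 2 * (dl + (pi + dr)) + (ul + (x + ur)) + [ e >0]) (+-suc i j) ⟩
    2 * (dl + (pi + dr)) + (ul + (x + ur)) + 1
      ≡⟨ solve 6 (λ dl pi dr ul x ur → con 2 :* (dl :+ (pi :+ dr)) :+ (ul :+ (x :+ ur)) :+ con 1
          := (con 2 :* dl :+ ul :+ pi) :+ (con 1 :+ (con 2 :* dr :+ ur :+ (pi :+ x)))) refl dl pi dr ul x ur ⟩
    (2 * dl + ul + pi) + suc (2 * dr + ur + (pi + x))
      ≡⟨ cong₂ (λ a b → a + suc b) (node-count l (m+n≡0⇒m≡0 (ddᵀ l) dd≡0))
           (trans (cong (2 * dr + ur +_) (children-count i j (m+n≡0⇒m≡0 (doubleDescent i j) rest≡0)))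
                  (node-count r (m+n≡0⇒n≡0 (doubleDescent i j) rest≡0))) ⟩
    i + suc j ∎
    where
    open ≡-Reasoning
    open +-*-Solver
    i = size l
    j = size r
    dl = desᵀ l
    dr = desᵀ r
    ul = rightOnlyᵀ l
    ur = rightOnlyᵀ r
    pi = [ i >0]
    x  = rightOnly i j
    rest≡0 = m+n≡0⇒n≡0 (ddᵀ l) dd≡0

  module _ {n : ℕ} (T : Tree) (size≡ : size T ≡ suc n) (dd≡0 : ddᵀ T ≡ 0) where

    private
      count≡ : 2 * desᵀ T + rightOnlyᵀ T ≡ n
      count≡ = suc-injective (trans (+-comm 1 _) (trans
        (subst (λ s → 2 * desᵀ T + rightOnlyᵀ T + [ s >0] ≡ size T) size≡ (node-count T dd≡0)) size≡))

    rightOnlyᵀ≡ : n ∸ 2 * desᵀ T ≡ rightOnlyᵀ T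
    rightOnlyᵀ≡ = trans (cong (_∸ 2 * desᵀ T) (sym count≡)) (m+n∸m≡n (2 * desᵀ T) _)

    desᵀ≤half : desᵀ T ≤ ⌊ n /2⌋
    desᵀ≤half = begin
      desᵀ T                    ≡⟨ n≡⌊n+n/2⌋ (desᵀ T) ⟩
      ⌊ desᵀ T + desᵀ T /2⌋     ≡⟨ cong (λ d → ⌊ desᵀ T + d /2⌋) (+-identityʳ _) ⟨
      ⌊ 2 * desᵀ T /2⌋          ≤⟨ ⌊n/2⌋-mono (≤-trans (m≤m+n _ _) (≤-reflexive count≡)) ⟩
      ⌊ n /2⌋                   ∎
      where open ≤-Reasoning

open Combinatorics

import Algebra.Properties.CommutativeSemigroup as CommutativeSemigroup
import Algebra.Properties.CommutativeSemiring.Exp as Exp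
open import Data.Bool.Base using (if_then_else_)
open import Data.List.Properties using (applyUpTo-∷ʳ)
import Data.Nat.Properties as ℕ
open import Relation.Binary.PropositionalEquality as ≡ using (_≡_; _≢_)

-- Finite sums in a commutative semiring

module Sums {c ℓ} (R : CommutativeSemiring c ℓ) where

  open CommutativeSemiring R hiding (zero)
  open Sum R public
  open import Relation.Binary.Reasoning.Setoid setoid
  open CommutativeSemigroup +-commutativeSemigroup using (x∙yz≈y∙xz; interchange)

  ∑-cong : ∀ {a} {A : Set a} (xs : List A) {f g : A → Carrier} →
           (∀ {x} → x ∈ xs → f x ≈ g x) → ∑ xs f ≈ ∑ xs g
  ∑-cong []       h = refl
  ∑-cong (x ∷ xs) h = +-cong (h (here ≡.refl)) (∑-cong xs (h ∘ there))

  ∑-zero : ∀ {a} {A : Set a} (xs : List A) {f : A → Carrier} → (∀ {x} → x ∈ xs → f x ≈ 0#) → ∑ xs f ≈ 0#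
  ∑-zero []       h = refl
  ∑-zero (x ∷ xs) h = trans (+-cong (h (here ≡.refl)) (∑-zero xs (h ∘ there))) (+-identityˡ 0#)

  ∑-+ : ∀ {a} {A : Set a} (xs : List A) (f g : A → Carrier) → ∑ xs (λ x → f x + g x) ≈ ∑ xs f + ∑ xs g
  ∑-+ []       f g = sym (+-identityˡ 0#)
  ∑-+ (x ∷ xs) f g = trans (+-congˡ (∑-+ xs f g)) (interchange _ _ _ _)

  ∑-*ˡ : ∀ {a} {A : Set a} (xs : List A) c (f : A → Carrier) → ∑ xs (λ x → c * f x) ≈ c * ∑ xs f
  ∑-*ˡ []       c f = sym (zeroʳ c)
  ∑-*ˡ (x ∷ xs) c f = trans (+-congˡ (∑-*ˡ xs c f)) (sym (distribˡ c _ _))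

  ∑-*ʳ : ∀ {a} {A : Set a} (xs : List A) c (f : A → Carrier) → ∑ xs (λ x → f x * c) ≈ ∑ xs f * c
  ∑-*ʳ []       c f = sym (zeroˡ c)
  ∑-*ʳ (x ∷ xs) c f = trans (+-congˡ (∑-*ʳ xs c f)) (sym (distribʳ c _ _))

  ∑-++ : ∀ {a} {A : Set a} (xs ys : List A) (f : A → Carrier) → ∑ (xs ++ ys) f ≈ ∑ xs f + ∑ ys f
  ∑-++ []       ys f = sym (+-identityˡ _)
  ∑-++ (x ∷ xs) ys f = trans (+-congˡ (∑-++ xs ys f)) (sym (+-assoc _ _ _))

  ∑-map : ∀ {a b} {A : Set a} {B : Set b} (g : A → B) xs (f : B → Carrier) → ∑ (map g xs) f ≈ ∑ xs (f ∘ g)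
  ∑-map g []       f = refl
  ∑-map g (x ∷ xs) f = +-congˡ (∑-map g xs f)

  ∑-concatMap : ∀ {a b} {A : Set a} {B : Set b} (g : A → List B) xs (f : B → Carrier) →
                ∑ (concatMap g xs) f ≈ ∑[ x ∈ xs ] (∑ (g x) f)
  ∑-concatMap g []       f = refl
  ∑-concatMap g (x ∷ xs) f = trans (∑-++ (g x) _ f) (+-congˡ (∑-concatMap g xs f))

  ∑-cartesianProductWith : ∀ {A B C : Set} (g : A → B → C) xs ys (f : C → Carrier) →
    ∑ (cartesianProductWith g xs ys) f ≈ ∑[ x ∈ xs ] (∑[ y ∈ ys ] (f (g x y)))
  ∑-cartesianProductWith g []       ys f = refl
  ∑-cartesianProductWith g (x ∷ xs) ys f = trans (∑-++ (map (g x) ys) _ f)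
    (+-cong (∑-map (g x) ys f) (∑-cartesianProductWith g xs ys f))

  ∑-remove : ∀ {a} {A : Set a} (xs : List A) y ys (f : A → Carrier) → ∑ (xs ++ y ∷ ys) f ≈ f y + ∑ (xs ++ ys) f
  ∑-remove xs y ys f = begin
    ∑ (xs ++ y ∷ ys) f           ≈⟨ ∑-++ xs (y ∷ ys) f ⟩
    ∑ xs f + (f y + ∑ ys f)      ≈⟨ x∙yz≈y∙xz _ _ _ ⟩
    f y + (∑ xs f + ∑ ys f)      ≈⟨ +-congˡ (∑-++ xs ys f) ⟨
    f y + ∑ (xs ++ ys) f         ∎

  ∑-single : ∀ {a} {A : Set a} {xs : List A} {f : A → Carrier} {x} → Unique xs → x ∈ xs →
             (∀ {y} → y ≢ x → f y ≈ 0#) → ∑ xs f ≈ f x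
  ∑-single (x∉ ∷ _) (here ≡.refl) others =
    trans (+-congˡ (∑-zero _ λ y∈ → others (All.lookup x∉ y∈ ∘ ≡.sym))) (+-identityʳ _)
  ∑-single (x∉ ∷ unique) (there x∈) others =
    trans (+-cong (others (All.lookup x∉ x∈)) (∑-single unique x∈ others)) (+-identityˡ _)

  module _ {A B : Set} (_~_ : A → B → Set)
           (functional : ∀ {x y y′} → x ~ y → x ~ y′ → y ≡ y′)
           (injective : ∀ {x x′ y} → x ~ y → x′ ~ y → x ≡ x′)
           {f : A → Carrier} {g : B → Carrier} (f≈g : ∀ {x y} → x ~ y → f x ≈ g y) where

    -- The partner `y` of the head is cut out of `ys`. Injectivity keeps the partners of the tail
    -- away from `y`; functionality and uniqueness of `ys` keep the partners of the remaining
    -- elements away from the head.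
    ∑-bijection : ∀ {xs ys} → Unique xs → Unique ys →
      (∀ {x} → x ∈ xs → ∃ λ y → y ∈ ys × x ~ y) →
      (∀ {y} → y ∈ ys → ∃ λ x → x ∈ xs × x ~ y) →
      ∑ xs f ≈ ∑ ys g
    ∑-bijection {[]} {[]}     _ _ _ _ = refl
    ∑-bijection {[]} {y ∷ ys} _ _ _ back with () ← proj₁ (proj₂ (back (here ≡.refl)))
    ∑-bijection {x ∷ xs} (x∉ ∷ xs!) ys! to back
      with y , y∈ , x~y ← to (here ≡.refl)
      with us , vs , ≡.refl ← ∈-∃++ y∈
      = trans (+-cong (f≈g x~y) (∑-bijection xs! us++vs! to′ back′)) (sym (∑-remove us y vs g))
      where
      remove! : ∀ us → Unique (us ++ y ∷ vs) → Unique (us ++ vs) × ¬ y ∈ us ++ vs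
      remove! []       (y∉ ∷ vs!) = vs! , λ y∈vs → All.lookup y∉ y∈vs ≡.refl
      remove! (u ∷ us) (u∉ ∷ us!) with us++vs! , y∉ ← remove! us us! =
        (All.tabulate (λ {v} v∈ → All.lookup u∉ (insert us v∈)) ∷ us++vs!) ,
        λ { (here ≡.refl) → All.lookup u∉ (∈-insert us) ≡.refl ; (there y∈) → y∉ y∈ }
        where
        insert : ∀ us {v} → v ∈ us ++ vs → v ∈ us ++ y ∷ vs
        insert us v∈ with ∈-++⁻ us v∈
        ... | inj₁ v∈us = ∈-++⁺ˡ v∈us
        ... | inj₂ v∈vs = ∈-++⁺ʳ us (there v∈vs)
      us++vs! = proj₁ (remove! us ys!)
      y∉ = proj₂ (remove! us ys!)
      to′ : ∀ {x′} → x′ ∈ xs → ∃ λ y′ → y′ ∈ us ++ vs × x′ ~ y′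
      to′ x′∈ with y′ , y′∈ , x′~y′ ← to (there x′∈) with ∈-++⁻ us y′∈
      ... | inj₁ y′∈us = y′ , ∈-++⁺ˡ y′∈us , x′~y′
      ... | inj₂ (there y′∈vs) = y′ , ∈-++⁺ʳ us y′∈vs , x′~y′
      ... | inj₂ (here ≡.refl) = contradiction (injective x~y x′~y′) (All.lookup x∉ x′∈)
      back′ : ∀ {y′} → y′ ∈ us ++ vs → ∃ λ x′ → x′ ∈ xs × x′ ~ y′
      back′ {y′} y′∈ with back (weaken (∈-++⁻ us y′∈))
        where
        weaken : _ → y′ ∈ us ++ y ∷ vs
        weaken (inj₁ y′∈us) = ∈-++⁺ˡ y′∈us
        weaken (inj₂ y′∈vs) = ∈-++⁺ʳ us (there y′∈vs)
      ... | x′ , there x′∈ , x′~y′ = x′ , x′∈ , x′~y′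
      ... | x′ , here ≡.refl , x~y′ with ≡.refl ← functional x~y x~y′ = contradiction y′∈ y∉

  -- Branching on `does` lets `keep` of a `×-dec` reduce to 0 as soon as the first component
  -- computes to false.
  keep : ∀ {p} {P : Set p} → Dec P → Carrier → Carrier
  keep P? x = if does P? then x else 0#

  keep-yes : ∀ {p} {P : Set p} (P? : Dec P) {x} → P → keep P? x ≈ x
  keep-yes (yes _) _ = refl
  keep-yes (no ¬p) p = contradiction p ¬p

  keep-no : ∀ {p} {P : Set p} (P? : Dec P) {x} → ¬ P → keep P? x ≈ 0#
  keep-no (yes p) ¬p = contradiction p ¬p
  keep-no (no _)  _  = refl

  -- Moves the selection by `k` into the summand. The expansion then becomes one sum over all
  -- avoiders of a function of their statistics, the only kind of sum that `Transport` carries over.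
  ∑-exchange : ∀ {a p} {A : Set a} {P : ℕ → A → Set p} (P? : ∀ k → Decidable (P k)) (xs : List A) (ks : List ℕ)
    (f : A → Carrier) (g : ℕ → Carrier) →
    ∑[ k ∈ ks ] (∑ (filter (P? k) xs) f * g k) ≈ ∑[ x ∈ xs ] (∑[ k ∈ ks ] keep (P? k x) (f x * g k))
  ∑-exchange P? []       ks f g = ∑-zero ks λ _ → zeroˡ _
  ∑-exchange P? (x ∷ xs) ks f g = begin
    ∑[ k ∈ ks ] (∑ (filter (P? k) (x ∷ xs)) f * g k)
      ≈⟨ ∑-cong ks (λ {k} _ → first k) ⟩
    ∑[ k ∈ ks ] (keep (P? k x) (f x * g k) + ∑ (filter (P? k) xs) f * g k)
      ≈⟨ ∑-+ ks _ _ ⟩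
    ∑[ k ∈ ks ] keep (P? k x) (f x * g k) + ∑[ k ∈ ks ] (∑ (filter (P? k) xs) f * g k)
      ≈⟨ +-congˡ (∑-exchange P? xs ks f g) ⟩
    ∑[ k ∈ ks ] keep (P? k x) (f x * g k) + ∑[ x ∈ xs ] (∑[ k ∈ ks ] keep (P? k x) (f x * g k)) ∎
    where
    first : ∀ k → ∑ (filter (P? k) (x ∷ xs)) f * g k ≈ keep (P? k x) (f x * g k) + ∑ (filter (P? k) xs) f * g k
    first k with P? k x
    ... | yes _ = distribʳ _ _ _
    ... | no  _ = sym (+-identityˡ _)

-- Transport of sums of any function of the three statistics, from 132 to 213 and from 213 to trees

module Transport {c ℓ} (R : CommutativeSemiring c ℓ) (n : ℕ) (F : ℕ → ℕ → ℕ → CommutativeSemiring.Carrier R) where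

  open CommutativeSemiring R hiding (zero)
  open Sums R

  private
    F-cong : ∀ {a a′ b b′ c c′} → a ≡ a′ → b ≡ b′ → c ≡ c′ → F a b c ≈ F a′ b′ c′
    F-cong ≡.refl ≡.refl ≡.refl = refl

  ∑-132≈213 : ∑[ π ∈ 𝔖 n τ132 ] (F (des π) (dd* π) (adi* π)) ≈ ∑[ π ∈ 𝔖 n τ213 ] (F (des π) (dd π) (adi π))
  ∑-132≈213 = ∑-bijection (λ (π π′ : Word n) → π ≡ rc π′)
    (λ {_} {π} {π′} e e′ → ≡.trans (≡.sym (rc-involutive π)) (≡.trans (≡.cong rc (≡.trans (≡.sym e) e′)) (rc-involutive π′)))
    (λ e e′ → ≡.trans e (≡.sym e′))
    {f = λ π → F (des π) (dd* π) (adi* π)}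
    (λ { {y = π} ≡.refl → F-cong (des-rc π) (dd*-rc π) (adi*-rc π) })
    (𝔖-unique τ132) (𝔖-unique τ213)
    -- `rc τ213` computes to `τ132`, and `rc τ132` to `τ213`.
    (λ {π} π∈ → rc π , ∈-𝔖⁺ τ213 (rc-avoiding τ213 π (∈-𝔖⁻ τ132 π∈)) , ≡.sym (rc-involutive π))
    (λ {π} π∈ → rc π , ∈-𝔖⁺ τ132 (rc-avoiding τ132 π (∈-𝔖⁻ τ213 π∈)) , ≡.refl)

  ∑-213≈trees : ∑[ π ∈ 𝔖 n τ213 ] (F (des π) (dd π) (adi π)) ≈ ∑[ T ∈ trees n n ] (F (desᵀ T) (ddᵀ T) (adiᵀ T))
  ∑-213≈trees = ∑-bijection Tree-of Tree-of-functional Tree-of-injective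
    (λ r → F-cong (des≡desᵀ r) (dd≡ddᵀ r) (adi≡adiᵀ r))
    (𝔖-unique τ213) (trees-unique n n)
    (λ {π} π∈ → let T , r = tree π (∈-𝔖⁻ τ213 π∈) in T , member (proj₁ (proj₂ r)) , r)
    (λ {T} T∈ → let π , r = word T (size-trees n n T∈) in π , ∈-𝔖⁺ τ213 (Tree-of⇒avoiding r) , r)
    where
    member : ∀ {T} → size T ≡ n → T ∈ trees n n
    member {T} ≡.refl = ∈-trees n T ℕ.≤-refl

-- Tree sums of weights that are products over the nodes

module Kernel {c ℓ} (R : CommutativeSemiring c ℓ) where

  open CommutativeSemiring R hiding (zero)
  open Sums R
  open import Relation.Binary.Reasoning.Setoid setoid

  weight : (ℕ → ℕ → Carrier) → Tree → Carrier
  weight κ leaf       = 1#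
  weight κ (node l r) = κ (size l) (size r) * (weight κ l * weight κ r)

  total : (ℕ → ℕ → Carrier) → ℕ → ℕ → Carrier
  total κ f n = ∑ (trees f n) (weight κ)

  convolution : (ℕ → ℕ → Carrier) → ℕ → ℕ → ℕ → Carrier
  convolution κ f n i = κ i (n ∸ i) * (total κ f i * total κ f (n ∸ i))

  -- Once the size of the left subtree is fixed, the factor of the root is constant and the sum over
  -- pairs of subtrees is a product.
  total-suc : ∀ κ f n → total κ (suc f) (suc n) ≈ ∑ (upTo (suc n)) (convolution κ f n)
  total-suc κ f n = trans (∑-concatMap (joins (trees f) n) (upTo (suc n)) (weight κ))
    (∑-cong (upTo (suc n)) λ {i} _ → begin
      ∑ (joins (trees f) n i) (weight κ)
        ≈⟨ ∑-cartesianProductWith node (trees f i) (trees f (n ∸ i)) (weight κ) ⟩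
      ∑[ l ∈ trees f i ] (∑[ r ∈ trees f (n ∸ i) ] (κ (size l) (size r) * (weight κ l * weight κ r)))
        ≈⟨ ∑-cong (trees f i) (λ {l} l∈ → ∑-cong (trees f (n ∸ i)) λ {r} r∈ →
             *-congʳ (reflexive (≡.cong₂ κ (size-trees f i l∈) (size-trees f (n ∸ i) r∈)))) ⟩
      ∑[ l ∈ trees f i ] (∑[ r ∈ trees f (n ∸ i) ] (κ i (n ∸ i) * (weight κ l * weight κ r)))
        ≈⟨ ∑-cong (trees f i) (λ {l} _ → trans (∑-*ˡ (trees f (n ∸ i)) _ _) (*-congˡ (∑-*ˡ (trees f (n ∸ i)) _ _))) ⟩
      ∑[ l ∈ trees f i ] (κ i (n ∸ i) * (weight κ l * total κ f (n ∸ i)))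
        ≈⟨ trans (∑-*ˡ (trees f i) _ _) (*-congˡ (∑-*ʳ (trees f i) _ _)) ⟩
      convolution κ f n i ∎)

  -- Groups the two splittings in which the root has one child, which are comparable only as a pair.
  ∑-ends : ∀ m (g : ℕ → Carrier) → ∑ (upTo (2 ℕ.+ m)) g ≈ (g 0 + g (suc m)) + ∑ (applyUpTo suc m) g
  ∑-ends m g = begin
    g 0 + ∑ (applyUpTo suc (suc m)) g
      ≡⟨ ≡.cong (λ xs → g 0 + ∑ xs g) (applyUpTo-∷ʳ suc m) ⟨
    g 0 + ∑ (applyUpTo suc m ++ suc m ∷ []) g
      ≈⟨ +-congˡ (trans (∑-remove (applyUpTo suc m) (suc m) [] g) (+-congˡ (∑-++[] (applyUpTo suc m)))) ⟩
    g 0 + (g (suc m) + ∑ (applyUpTo suc m) g)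
      ≈⟨ +-assoc _ _ _ ⟨
    (g 0 + g (suc m)) + ∑ (applyUpTo suc m) g ∎
    where
    ∑-++[] : ∀ xs → ∑ (xs ++ []) g ≈ ∑ xs g
    ∑-++[] xs = trans (∑-++ xs [] g) (+-identityʳ _)

  -- Left-only and right-only nodes occur in pairs (0 , m) and (m , 0) with the same subtree.
  total-cong : ∀ {κ κ′} → κ 0 0 ≈ κ′ 0 0 →
    (∀ m → κ 0 (suc m) + κ (suc m) 0 ≈ κ′ 0 (suc m) + κ′ (suc m) 0) →
    (∀ i j → κ (suc i) (suc j) ≈ κ′ (suc i) (suc j)) →
    ∀ f n → total κ f n ≈ total κ′ f n
  total-cong {κ} {κ′} κ₀₀ κ-ends κ-inner = go
    where
    go : ∀ f n → total κ f n ≈ total κ′ f n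
    ends : ∀ κ f m → convolution κ f (suc m) 0 + convolution κ f (suc m) (suc m) ≈
                     (κ 0 (suc m) + κ (suc m) 0) * (total κ f 0 * total κ f (suc m))
    ends κ f m = begin
      convolution κ f (suc m) 0 + κ (suc m) (m ∸ m) * (total κ f (suc m) * total κ f (m ∸ m))
        ≡⟨ ≡.cong (λ z → convolution κ f (suc m) 0 + κ (suc m) z * (total κ f (suc m) * total κ f z)) (ℕ.n∸n≡0 m) ⟩
      convolution κ f (suc m) 0 + κ (suc m) 0 * (total κ f (suc m) * total κ f 0)
        ≈⟨ +-congˡ (*-congˡ (*-comm _ _)) ⟩
      convolution κ f (suc m) 0 + κ (suc m) 0 * (total κ f 0 * total κ f (suc m))
        ≈⟨ distribʳ _ _ _ ⟨
      (κ 0 (suc m) + κ (suc m) 0) * (total κ f 0 * total κ f (suc m)) ∎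
    inner : ∀ f m {i} → i ∈ applyUpTo suc m → convolution κ f (suc m) i ≈ convolution κ′ f (suc m) i
    inner f m i∈ with i , i<m , ≡.refl ← ∈-applyUpTo⁻ suc i∈ = *-cong
      (≡.subst (λ j → κ (suc i) j ≈ κ′ (suc i) j) (≡.sym (ℕ.+-∸-assoc 1 i<m)) (κ-inner i (m ∸ suc i)))
      (*-cong (go f (suc i)) (go f (m ∸ i)))
    go f       zero    = refl
    go zero    (suc n) = refl
    -- With a single node the splittings `0 , m` and `m , 0` coincide, so the childless root is
    -- treated apart.
    go (suc f) (suc zero) = begin
      total κ (suc f) 1              ≈⟨ total-suc κ f 0 ⟩
      convolution κ f 0 0 + 0#       ≈⟨ +-congʳ (*-congʳ κ₀₀) ⟩
      convolution κ′ f 0 0 + 0#      ≈⟨ total-suc κ′ f 0 ⟨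
      total κ′ (suc f) 1             ∎
    go (suc f) (suc (suc m)) = begin
      total κ (suc f) (2 ℕ.+ m)
        ≈⟨ trans (total-suc κ f (suc m)) (∑-ends m _) ⟩
      (convolution κ f (suc m) 0 + convolution κ f (suc m) (suc m)) + ∑ (applyUpTo suc m) (convolution κ f (suc m))
        ≈⟨ +-cong (trans (ends κ f m) (trans (*-cong (κ-ends m) (*-congˡ (go f (suc m)))) (sym (ends κ′ f m))))
                  (∑-cong (applyUpTo suc m) (inner f m)) ⟩
      (convolution κ′ f (suc m) 0 + convolution κ′ f (suc m) (suc m)) + ∑ (applyUpTo suc m) (convolution κ′ f (suc m))
        ≈⟨ trans (total-suc κ′ f (suc m)) (∑-ends m _) ⟨
      total κ′ (suc f) (2 ℕ.+ m) ∎

-- The two weights, their comparison, and the expansion in powers of 1 + t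

module Gamma {c ℓ} (R : CommutativeSemiring c ℓ) (t q : CommutativeSemiring.Carrier R) where

  open CommutativeSemiring R hiding (zero)
  open Sums R
  open Kernel R
  open Exp R
  open import Relation.Binary.Reasoning.Setoid setoid
  open CommutativeSemigroup *-commutativeSemigroup using (x∙yz≈y∙xz; interchange)

  -- Weights put the root before its subtrees, the tree statistics put it between them.
  ^-+₃ : ∀ x a b c → x ^ b * (x ^ a * x ^ c) ≈ x ^ (a ℕ.+ (b ℕ.+ c))
  ^-+₃ x a b c = begin
    x ^ b * (x ^ a * x ^ c)       ≈⟨ x∙yz≈y∙xz _ _ _ ⟩
    x ^ a * (x ^ b * x ^ c)       ≈⟨ *-congˡ (^-homo-* x b c) ⟨
    x ^ a * x ^ (b ℕ.+ c)         ≈⟨ ^-homo-* x a (b ℕ.+ c) ⟨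
    x ^ (a ℕ.+ (b ℕ.+ c))         ∎

  interchange₃ : ∀ a b c d e f → (a * b) * ((c * d) * (e * f)) ≈ (a * (c * e)) * (b * (d * f))
  interchange₃ a b c d e f = trans (*-congˡ (interchange c d e f)) (interchange a b (c * e) (d * f))

  desAdi : ℕ → ℕ → Carrier
  desAdi i j = t ^ [ i >0] * q ^ cross i j

  weight-desAdi : ∀ T → weight desAdi T ≈ t ^ desᵀ T * q ^ adiᵀ T
  weight-desAdi leaf       = sym (*-identityˡ 1#)
  weight-desAdi (node l r) = begin
    desAdi i j * (weight desAdi l * weight desAdi r)
      ≈⟨ *-congˡ (*-cong (weight-desAdi l) (weight-desAdi r)) ⟩
    (t ^ [ i >0] * q ^ cross i j) * ((t ^ desᵀ l * q ^ adiᵀ l) * (t ^ desᵀ r * q ^ adiᵀ r))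
      ≈⟨ interchange₃ _ _ _ _ _ _ ⟩
    (t ^ [ i >0] * (t ^ desᵀ l * t ^ desᵀ r)) * (q ^ cross i j * (q ^ adiᵀ l * q ^ adiᵀ r))
      ≈⟨ *-cong (^-+₃ t (desᵀ l) [ i >0] (desᵀ r)) (^-+₃ q (adiᵀ l) (cross i j) (adiᵀ r)) ⟩
    t ^ desᵀ (node l r) * q ^ (adiᵀ l ℕ.+ (cross i j ℕ.+ adiᵀ r)) ∎
    where
    i = size l
    j = size r

  -- An indicator of vanishing. Since a sum of naturals is 0 only when all summands are, `unless-*`
  -- makes the absence of double descents a product over the nodes.
  unless : ℕ → Carrier → Carrier
  unless zero    x = x
  unless (suc _) x = 0#

  unless-cong : ∀ a {x y} → x ≈ y → unless a x ≈ unless a y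
  unless-cong zero    x≈y = x≈y
  unless-cong (suc _) _   = refl

  unless-* : ∀ a b c x y z → unless b x * (unless a y * unless c z) ≈ unless (a ℕ.+ (b ℕ.+ c)) (x * (y * z))
  unless-* (suc a) b       c       x y z = trans (*-congˡ (zeroˡ _)) (zeroʳ _)
  unless-* zero    (suc b) c       x y z = zeroˡ _
  unless-* zero    zero    (suc c) x y z = trans (*-congˡ (zeroʳ _)) (zeroʳ _)
  unless-* zero    zero    zero    x y z = refl

  -- The factor 1 + t of a right-only node also accounts for the left-only one, which
  -- is a double descent.
  gamma : ℕ → ℕ → Carrier
  gamma i j = unless (doubleDescent i j) (desAdi i j * (1# + t) ^ rightOnly i j)

  weight-gamma : ∀ T → weight gamma T ≈ unless (ddᵀ T) ((t ^ desᵀ T * q ^ adiᵀ T) * (1# + t) ^ rightOnlyᵀ T)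
  weight-gamma T = trans (expand T) (unless-cong (ddᵀ T) (*-congʳ (weight-desAdi T)))
    where
    expand : ∀ T → weight gamma T ≈ unless (ddᵀ T) (weight desAdi T * (1# + t) ^ rightOnlyᵀ T)
    expand leaf       = sym (*-identityˡ 1#)
    expand (node l r) = begin
      gamma i j * (weight gamma l * weight gamma r)
        ≈⟨ *-congˡ (*-cong (expand l) (expand r)) ⟩
      gamma i j * (unless (ddᵀ l) _ * unless (ddᵀ r) _)
        ≈⟨ unless-* (ddᵀ l) (doubleDescent i j) (ddᵀ r) _ _ _ ⟩
      unless (ddᵀ (node l r)) (_ * (_ * _))
        ≈⟨ unless-cong (ddᵀ (node l r)) (trans (interchange₃ _ _ _ _ _ _)
             (*-congˡ (^-+₃ (1# + t) (rightOnlyᵀ l) (rightOnly i j) (rightOnlyᵀ r)))) ⟩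
      unless (ddᵀ (node l r)) (weight desAdi (node l r) * (1# + t) ^ rightOnlyᵀ (node l r)) ∎
      where
      i = size l
      j = size r

  total-desAdi≈gamma : ∀ f n → total desAdi f n ≈ total gamma f n
  total-desAdi≈gamma = total-cong (sym (*-identityʳ _)) ends (λ i j → sym (*-identityʳ _))
    where
    ends : ∀ m → desAdi 0 (suc m) + desAdi (suc m) 0 ≈ gamma 0 (suc m) + gamma (suc m) 0
    ends m = begin
      -- A lone right child contributes 1 and a lone left child `t`; `cross (suc m) 0` reduces to
      -- `m * 0`, so no power of `q` remains.
      1# * 1# + (t * 1#) * q ^ cross (suc m) 0
        ≈⟨ +-cong (*-identityˡ 1#) (*-cong (*-identityʳ t) (^-congʳ q (ℕ.*-zeroʳ m))) ⟩
      1# + t * 1#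
        ≈⟨ +-congˡ (*-identityʳ t) ⟩
      1# + t
        ≈⟨ *-identityʳ (1# + t) ⟨
      (1# + t) * 1#
        ≈⟨ *-identityˡ ((1# + t) * 1#) ⟨
      1# * ((1# + t) * 1#)
        ≈⟨ *-congʳ (*-identityˡ 1#) ⟨
      (1# * 1#) * ((1# + t) * 1#)
        ≈⟨ +-identityʳ _ ⟨
      (1# * 1#) * ((1# + t) * 1#) + 0# ∎

  coefficient : ℕ → ℕ → Carrier
  coefficient n k = t ^ k * (1# + t) ^ (n ∸ 1 ∸ 2 ℕ.* k)

  -- What a single permutation with `e` descents, `d` double descents and `x` admissible inversions
  -- contributes to the expansion.
  gammaTerm : ℕ → ℕ → ℕ → ℕ → Carrier
  gammaTerm n e d x =
    ∑[ k ∈ upTo (suc ⌊ n ∸ 1 /2⌋) ] keep ((d ℕ.≟ 0) ×-dec (e ℕ.≟ k)) (q ^ x * coefficient n k)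

  -- Without double descents only `k` equal to `desᵀ T` survives: `desᵀ≤half` places it in the range
  -- of summation, and `rightOnlyᵀ≡` identifies the exponent of 1 + t. Otherwise both sides are 0.
  gammaTerm-tree : ∀ n T → size T ≡ suc n → gammaTerm (suc n) (desᵀ T) (ddᵀ T) (adiᵀ T) ≈ weight gamma T
  gammaTerm-tree n T size≡ = trans (evaluate (ddᵀ T) ≡.refl) (sym (weight-gamma T))
    where
    e = desᵀ T
    x = adiᵀ T
    K = suc ⌊ n /2⌋
    evaluate : ∀ d → ddᵀ T ≡ d →
      gammaTerm (suc n) e d x ≈ unless d ((t ^ e * q ^ x) * (1# + t) ^ rightOnlyᵀ T)
    evaluate (suc d) _    = ∑-zero (upTo K) λ _ → refl
    evaluate zero    dd≡0 = begin
      gammaTerm (suc n) e 0 x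
        ≈⟨ ∑-single (Unique.upTo⁺ K) (∈-upTo⁺ (s≤s (desᵀ≤half T size≡ dd≡0)))
             (λ {k} k≢e → keep-no ((0 ℕ.≟ 0) ×-dec (e ℕ.≟ k)) (k≢e ∘ ≡.sym ∘ proj₂)) ⟩
      keep ((0 ℕ.≟ 0) ×-dec (e ℕ.≟ e)) (q ^ x * coefficient (suc n) e)
        ≈⟨ keep-yes ((0 ℕ.≟ 0) ×-dec (e ℕ.≟ e)) (≡.refl , ≡.refl) ⟩
      q ^ x * (t ^ e * (1# + t) ^ (n ∸ 2 ℕ.* e))
        ≈⟨ x∙yz≈y∙xz _ _ _ ⟩
      t ^ e * (q ^ x * (1# + t) ^ (n ∸ 2 ℕ.* e))
        ≈⟨ *-assoc _ _ _ ⟨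
      (t ^ e * q ^ x) * (1# + t) ^ (n ∸ 2 ℕ.* e)
        ≈⟨ *-congˡ (^-congʳ (1# + t) (rightOnlyᵀ≡ T size≡ dd≡0)) ⟩
      (t ^ e * q ^ x) * (1# + t) ^ rightOnlyᵀ T ∎

  module _ (n : ℕ) where
    open Transport R n

    A  = ∑[ π ∈ 𝔖 n τ213 ] (t ^ des π * q ^ adi π)
    A* = ∑[ π ∈ 𝔖 n τ132 ] (t ^ des π * q ^ adi* π)
    Γ  = ∑[ k ∈ upTo (suc ⌊ n ∸ 1 /2⌋) ] (∑[ π ∈ 𝔖̃213 n k ] (q ^ adi π) * coefficient n k)
    Γ* = ∑[ k ∈ upTo (suc ⌊ n ∸ 1 /2⌋) ] (∑[ π ∈ 𝔖̃132 n k ] (q ^ adi* π) * coefficient n k)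

    A*≈A : A* ≈ A
    A*≈A = ∑-132≈213 λ e _ x → t ^ e * q ^ x

    Γ-as-sum : Γ ≈ ∑[ π ∈ 𝔖 n τ213 ] gammaTerm n (des π) (dd π) (adi π)
    Γ-as-sum = ∑-exchange (λ k π → (dd π ℕ.≟ 0) ×-dec (des π ℕ.≟ k)) (𝔖 n τ213) (upTo (suc ⌊ n ∸ 1 /2⌋))
      (λ π → q ^ adi π) (coefficient n)

    Γ*-as-sum : Γ* ≈ ∑[ π ∈ 𝔖 n τ132 ] gammaTerm n (des π) (dd* π) (adi* π)
    Γ*-as-sum = ∑-exchange (λ k π → (dd* π ℕ.≟ 0) ×-dec (des π ℕ.≟ k)) (𝔖 n τ132) (upTo (suc ⌊ n ∸ 1 /2⌋))
      (λ π → q ^ adi* π) (coefficient n)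

    Γ*≈Γ : Γ* ≈ Γ
    Γ*≈Γ = trans Γ*-as-sum (trans (∑-132≈213 (gammaTerm n)) (sym Γ-as-sum))

  A≈Γ : ∀ n → A (suc n) ≈ Γ (suc n)
  A≈Γ n = begin
    A (suc n)
      ≈⟨ ∑-213≈trees (λ e _ x → t ^ e * q ^ x) ⟩
    ∑[ T ∈ trees (suc n) (suc n) ] (t ^ desᵀ T * q ^ adiᵀ T)
      ≈⟨ ∑-cong (trees (suc n) (suc n)) (λ {T} _ → weight-desAdi T) ⟨
    total desAdi (suc n) (suc n)
      ≈⟨ total-desAdi≈gamma (suc n) (suc n) ⟩
    total gamma (suc n) (suc n)
      ≈⟨ ∑-cong (trees (suc n) (suc n)) (λ {T} T∈ → gammaTerm-tree n T (size-trees (suc n) (suc n) T∈)) ⟨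
    ∑[ T ∈ trees (suc n) (suc n) ] gammaTerm (suc n) (desᵀ T) (ddᵀ T) (adiᵀ T)
      ≈⟨ ∑-213≈trees (gammaTerm (suc n)) ⟨
    ∑[ π ∈ 𝔖 (suc n) τ213 ] gammaTerm (suc n) (des π) (dd π) (adi π)
      ≈⟨ Γ-as-sum (suc n) ⟨
    Γ (suc n) ∎
    where open Transport R (suc n)

theorem1p3 : ∀ {c ℓ} (R : CommutativeSemiring c ℓ) (t q : CommutativeSemiring.Carrier R) (n : ℕ) → 1 ≤ n →
    let
    open CommutativeSemiring R
    open Sum R
    _^_ = pow semiring
    A  = ∑[ π ∈ 𝔖 n τ213 ] ((t ^ des π) * (q ^ adi π))
    A* = ∑[ π ∈ 𝔖 n τ132 ] ((t ^ des π) * (q ^ adi* π))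
    Γ  = ∑[ k ∈ upTo (suc ⌊ n ∸ 1 /2⌋) ] ((∑[ π ∈ 𝔖̃213 n k ] (q ^ adi π)) * ((t ^ k) * ((1# + t) ^ (n ∸ 1 ∸ 2 ℕ.* k))))
    Γ* = ∑[ k ∈ upTo (suc ⌊ n ∸ 1 /2⌋) ] ((∑[ π ∈ 𝔖̃132 n k ] (q ^ adi* π)) * ((t ^ k) * ((1# + t) ^ (n ∸ 1 ∸ 2 ℕ.* k))))
    in A ≈ A* × A* ≈ Γ × Γ ≈ Γ*
theorem1p3 R t q (suc n) _ =
  sym (A*≈A (suc n)) , trans (A*≈A (suc n)) (A≈Γ n) , sym (Γ*≈Γ (suc n))
  where
  open CommutativeSemiring R using (sym; trans)
  open Gamma R t q
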